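{- Let $\mathcal{O}$ be a Dedekind domain. Let $\mathcal{L}\supseteq \mathcal{K}$ be two nonzero ideals of $\mathcal{O}$ with $\mathcal{K}\subsetneq \mathcal{O}$, let $\mathcal{I}$ be the ideal given by the factorization $\mathcal{K}=\mathcal{L}\mathcal{I}$, and let $[a:b]\in \mathbb{PF}^1_{\mathcal{I}}$. Then there exists a co-torsion $\mathcal{O}$-submodule $M\subsetneq \mathcal{O}^2$ whose invariant factor ideals are $\mathcal{L}\supseteq \mathcal{K}$ and whose projective space invariant element is $[a:b]\in \mathbb{PF}^1_{\mathcal{I}}$.
   Context: An $\mathcal{O}$-submodule $M\subseteq \mathcal{O}^2$ is co-torsion if $\mathcal{O}^2/M$ is a torsion $\mathcal{O}$-module. Projective space: let $(\mathcal{O}^2)^{*}=\{(a,b)\in \mathcal{O}^2\mid \langle a\rangle +\langle b\rangle = \mathcal{O}\}$. For an ideal $\mathcal{I}\subseteq\mathcal{O}$, define the equivalence relation on $(\mathcal{O}^2)^*$ by $(a,b)\sim (c,d)$ iff $ad-bc\in \mathcal{I}$. Then $\mathbb{PF}^1_{\mathcal{I}}=(\mathcal{O}^2)^{*}/\sim$, and the class of $(a,b)$ is denoted $[a:b]$. Invariants of a co-torsion submodule $M\subsetneq\mathcal{O}^2$: there are finitely many distinct maximal ideals $\mathcal{M}_1,\dots,\mathcal{M}_r$ of $\mathcal{O}$ (the elementary maximal ideal divisors) and integers $0\le l_i\le k_i\ne 0$, $1\le i\le r$, with $\mathcal{O}^2/M\cong\bigoplus_{i=1}^r\big(\mathcal{O}/\mathcal{M}_i^{l_i}\oplus\mathcal{O}/\mathcal{M}_i^{k_i}\big)$.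 The invariant factor ideals are $\mathcal{L}=\prod_{i=1}^r\mathcal{M}_i^{l_i}\supseteq\mathcal{K}=\prod_{i=1}^r\mathcal{M}_i^{k_i}$, so that $\mathcal{O}^2/M\cong\mathcal{O}/\mathcal{L}\oplus\mathcal{O}/\mathcal{K}$. The projective space invariant ideal is $\mathcal{I}=\prod_{i=1}^r\mathcal{M}_i^{k_i-l_i}$, so $\mathcal{K}=\mathcal{L}\mathcal{I}$. The projective space invariant element of $M$ is the class $[a:b]\in\mathbb{PF}^1_{\mathcal{I}}$ of any $(a,b)\in(\mathcal{O}^2)^*$ for which there is $t\in\mathcal{L}\setminus\bigcup_{i=1}^r\mathcal{L}\mathcal{M}_i$ with $(ta,tb)\in M$; such a pair exists and its class in $\mathbb{PF}^1_{\mathcal{I}}$ depends only on $M$. -}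

module Defs where

open import Level using (Level; _⊔_) renaming (suc to lsuc)
open import Algebra.Bundles using (CommutativeMonoid; CommutativeRing)
open import Algebra.Module.Bundles using (Module)
open import Algebra.Module.Structures.Biased using (IsModuleFromLeft)
open import Algebra.Module.Morphism.Structures using (module ModuleMorphisms)
import Algebra.Module.Construct.DirectProduct as DirectProduct
import Algebra.Module.Construct.TensorUnit as TensorUnit
import Algebra.Module.Construct.Zero as Zero
import Algebra.Properties.AbelianGroup as AbelianGroupProperties
import Algebra.Solver.Ring.NaturalCoefficients.Default as SemiringSolver
import Algebra.Properties.Ring as RingProperties
import Algebra.Properties.CommutativeSemigroup as CommutativeSemigroupProperties
open import Data.Fin.Base using (Fin; zero; suc)
open import Data.List.Base using (List; foldl)
open import Data.Nat.Base as ℕ using (ℕ; zero; suc)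
open import Data.Product.Base using (Σ-syntax; ∃; ∃-syntax; _×_; _,_)
open import Data.Sum.Base using (_⊎_; inj₁; inj₂)
open import Function.Base using (_∘_; flip)
open import Relation.Binary.Bundles using (Setoid)
open import Relation.Binary.PropositionalEquality.Core using (_≡_; _≢_)
open import Relation.Nullary.Negation.Core using (¬_)
open import Relation.Unary using (Pred)
import Relation.Binary.Reasoning.Setoid as SetoidReasoning

------------------------------------------------------------------------
-- Submodules and quotient modules

module _ {r ℓr : Level} {R : CommutativeRing r ℓr} where

  record Submodule {m ℓm : Level} (M : Module R m ℓm) (p : Level)
                   : Set (r ⊔ m ⊔ ℓm ⊔ lsuc p) where
    open CommutativeRing R using (Carrier)
    open Module M
    field
      member    : Pred Carrierᴹ p
      ≈-closed  : ∀ {x y} → x ≈ᴹ y → member x → member y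
      0-closed  : member 0ᴹ
      +-closed  : ∀ {x y} → member x → member y → member (x +ᴹ y)
      *ₗ-closed : ∀ (s : Carrier) {x} → member x → member (s *ₗ x)

  module _ {m ℓm : Level} {M : Module R m ℓm} where
    open CommutativeRing R using (Carrier)
    open Module M

    infix 4 _∈_ _∉_ _⊆_ _≐_

    _∈_ : ∀ {p} → Carrierᴹ → Submodule M p → Set p
    x ∈ N = Submodule.member N x

    _∉_ : ∀ {p} → Carrierᴹ → Submodule M p → Set p
    x ∉ N = ¬ (x ∈ N)

    _⊆_ : ∀ {p q} → Submodule M p → Submodule M q → Set (m ⊔ p ⊔ q)
    N ⊆ P = ∀ {x} → x ∈ N → x ∈ P

    _≐_ : ∀ {p q} → Submodule M p → Submodule M q → Set (m ⊔ p ⊔ q)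
    N ≐ P = N ⊆ P × P ⊆ N

    Proper : ∀ {p} → Submodule M p → Set (m ⊔ p)
    Proper N = ¬ (∀ x → x ∈ N)

    Nonzero : ∀ {p} → Submodule M p → Set (m ⊔ ℓm ⊔ p)
    Nonzero N = ∃[ x ] x ∈ N × ¬ (x ≈ᴹ 0ᴹ)

    data InSpan {p : Level} (P : Pred Carrierᴹ p) : Carrierᴹ → Set (r ⊔ m ⊔ ℓm ⊔ p) where
      generator : ∀ {x} → P x → InSpan P x
      ≈-span    : ∀ {x y} → x ≈ᴹ y → InSpan P x → InSpan P y
      0-span    : InSpan P 0ᴹ
      +-span    : ∀ {x y} → InSpan P x → InSpan P y → InSpan P (x +ᴹ y)
      *ₗ-span   : ∀ (s : Carrier) {x} → InSpan P x → InSpan P (s *ₗ x)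

    Span : ∀ {p} → Pred Carrierᴹ p → Submodule M (r ⊔ m ⊔ ℓm ⊔ p)
    Span P = record
      { member = InSpan P ; ≈-closed = ≈-span ; 0-closed = 0-span
      ; +-closed = +-span ; *ₗ-closed = *ₗ-span }

    Span-least : ∀ {p q} {P : Pred Carrierᴹ p} (N : Submodule M q) →
                 (∀ {x} → P x → x ∈ N) → Span P ⊆ N
    Span-least N P⇒N (generator Px)   = P⇒N Px
    Span-least N P⇒N (≈-span x≈y x∈)  = Submodule.≈-closed N x≈y (Span-least N P⇒N x∈)
    Span-least N P⇒N 0-span           = Submodule.0-closed N
    Span-least N P⇒N (+-span x∈ y∈)   = Submodule.+-closed N (Span-least N P⇒N x∈) (Span-least N P⇒N y∈)
    Span-least N P⇒N (*ₗ-span s x∈)   = Submodule.*ₗ-closed N s (Span-least N P⇒N x∈)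

    FinitelyGenerated : ∀ {p} → Submodule M p → Set (r ⊔ m ⊔ ℓm ⊔ p)
    FinitelyGenerated N =
      ∃[ n ] Σ[ v ∈ (Fin n → Carrierᴹ) ] N ≐ Span (λ x → ∃[ i ] x ≈ᴹ v i)

  infixl 7 _/_

  _/_ : ∀ {m ℓm p} (M : Module R m ℓm) → Submodule M p → Module R m p
  M / N = record
    { Carrierᴹ = Carrierᴹ ; _≈ᴹ_ = _∼_ ; _+ᴹ_ = _+ᴹ_ ; _*ₗ_ = _*ₗ_
    ; _*ᵣ_ = flip _*ₗ_ ; 0ᴹ = 0ᴹ ; -ᴹ_ = -ᴹ_
    ; isModule = IsModuleFromLeft.isModule {commutativeRing = R} record
      { isLeftModule = record
        { isLeftSemimodule = record
          { +ᴹ-isCommutativeMonoid = record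
            { isMonoid = record
              { isSemigroup = record
                { isMagma = record
                  { isEquivalence = record { refl = ∼-refl ; sym = ∼-sym ; trans = ∼-trans }
                  ; ∙-cong = ∼-+-cong
                  }
                ; assoc = λ x y z → lift (+ᴹ-assoc x y z)
                }
              ; identity = (λ x → lift (+ᴹ-identityˡ x)) , (λ x → lift (+ᴹ-identityʳ x))
              }
            ; comm = λ x y → lift (+ᴹ-comm x y)
            }
          ; isPreleftSemimodule = record
            { *ₗ-cong = ∼-*ₗ-cong
            ; *ₗ-zeroˡ = λ x → lift (*ₗ-zeroˡ x)
            ; *ₗ-distribʳ = λ x s t → lift (*ₗ-distribʳ x s t)
            ; *ₗ-identityˡ = λ x → lift (*ₗ-identityˡ x)
            ; *ₗ-assoc = λ s t x → lift (*ₗ-assoc s t x)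
            ; *ₗ-zeroʳ = λ s → lift (*ₗ-zeroʳ s)
            ; *ₗ-distribˡ = λ s x y → lift (*ₗ-distribˡ s x y)
            }
          }
        ; -ᴹ‿cong = ∼-neg-cong
        ; -ᴹ‿inverse = (λ x → lift (-ᴹ‿inverseˡ x)) , (λ x → lift (-ᴹ‿inverseʳ x))
        }
      }
    }
    where
    open CommutativeRing R using (Carrier; _≈_)
    open Module M
    open Submodule N
    open AbelianGroupProperties +ᴹ-abelianGroup
    open CommutativeSemigroupProperties
      (CommutativeMonoid.commutativeSemigroup +ᴹ-commutativeMonoid)
      using (interchange)
    open SetoidReasoning ≈ᴹ-setoid

    _∼_ : Carrierᴹ → Carrierᴹ → Set _
    x ∼ y = (x +ᴹ -ᴹ y) ∈ N

    lift : ∀ {x y} → x ≈ᴹ y → x ∼ y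
    lift {x} {y} x≈y = ≈-closed
      (≈ᴹ-sym (≈ᴹ-trans (+ᴹ-congʳ x≈y) (-ᴹ‿inverseʳ y))) 0-closed

    *ₗ-neg : ∀ s x → s *ₗ (-ᴹ x) ≈ᴹ -ᴹ (s *ₗ x)
    *ₗ-neg s x = inverseʳ-unique (s *ₗ x) (s *ₗ (-ᴹ x)) (begin
      s *ₗ x +ᴹ s *ₗ (-ᴹ x)  ≈⟨ *ₗ-distribˡ s x (-ᴹ x) ⟨
      s *ₗ (x +ᴹ -ᴹ x)       ≈⟨ *ₗ-congˡ (-ᴹ‿inverseʳ x) ⟩
      s *ₗ 0ᴹ                ≈⟨ *ₗ-zeroʳ s ⟩
      0ᴹ                     ∎)

    neg-closed : ∀ {x} → x ∈ N → (-ᴹ x) ∈ N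
    neg-closed {x} x∈N = ≈-closed (begin
      (- 1#) *ₗ x  ≈⟨ inverseʳ-unique x ((- 1#) *ₗ x) (begin
        x +ᴹ (- 1#) *ₗ x          ≈⟨ +ᴹ-congʳ (*ₗ-identityˡ x) ⟨
        1# *ₗ x +ᴹ (- 1#) *ₗ x    ≈⟨ *ₗ-distribʳ x 1# (- 1#) ⟨
        (1# + - 1#) *ₗ x          ≈⟨ *ₗ-congʳ (-‿inverseʳ 1#) ⟩
        0# *ₗ x                   ≈⟨ *ₗ-zeroˡ x ⟩
        0ᴹ                        ∎) ⟩
      -ᴹ x         ∎) (*ₗ-closed (- 1#) x∈N)
      where open CommutativeRing R using (-_; 1#; 0#; _+_; -‿inverseʳ)

    ∼-refl : ∀ {x} → x ∼ x
    ∼-refl = lift ≈ᴹ-refl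

    ∼-sym : ∀ {x y} → x ∼ y → y ∼ x
    ∼-sym {x} {y} x∼y = ≈-closed (begin
      -ᴹ (x +ᴹ -ᴹ y)      ≈⟨ ⁻¹-∙-comm x (-ᴹ y) ⟨
      -ᴹ x +ᴹ -ᴹ (-ᴹ y)   ≈⟨ +ᴹ-congˡ (⁻¹-involutive y) ⟩
      -ᴹ x +ᴹ y           ≈⟨ +ᴹ-comm (-ᴹ x) y ⟩
      y +ᴹ -ᴹ x           ∎) (neg-closed x∼y)

    ∼-trans : ∀ {x y z} → x ∼ y → y ∼ z → x ∼ z
    ∼-trans {x} {y} {z} x∼y y∼z = ≈-closed (begin
      (x +ᴹ -ᴹ y) +ᴹ (y +ᴹ -ᴹ z)  ≈⟨ +ᴹ-assoc x (-ᴹ y) (y +ᴹ -ᴹ z) ⟩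
      x +ᴹ (-ᴹ y +ᴹ (y +ᴹ -ᴹ z))  ≈⟨ +ᴹ-congˡ (+ᴹ-assoc (-ᴹ y) y (-ᴹ z)) ⟨
      x +ᴹ ((-ᴹ y +ᴹ y) +ᴹ -ᴹ z)  ≈⟨ +ᴹ-congˡ (+ᴹ-congʳ (-ᴹ‿inverseˡ y)) ⟩
      x +ᴹ (0ᴹ +ᴹ -ᴹ z)           ≈⟨ +ᴹ-congˡ (+ᴹ-identityˡ (-ᴹ z)) ⟩
      x +ᴹ -ᴹ z                   ∎) (+-closed x∼y y∼z)

    ∼-+-cong : ∀ {x y u v} → x ∼ y → u ∼ v → (x +ᴹ u) ∼ (y +ᴹ v)
    ∼-+-cong {x} {y} {u} {v} x∼y u∼v = ≈-closed (begin
      (x +ᴹ -ᴹ y) +ᴹ (u +ᴹ -ᴹ v)  ≈⟨ interchange x (-ᴹ y) u (-ᴹ v) ⟩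
      (x +ᴹ u) +ᴹ (-ᴹ y +ᴹ -ᴹ v)  ≈⟨ +ᴹ-congˡ (⁻¹-∙-comm y v) ⟩
      (x +ᴹ u) +ᴹ -ᴹ (y +ᴹ v)     ∎) (+-closed x∼y u∼v)

    ∼-*ₗ-cong : ∀ {s t x y} → s ≈ t → x ∼ y → (s *ₗ x) ∼ (t *ₗ y)
    ∼-*ₗ-cong {s} {t} {x} {y} s≈t x∼y = ≈-closed (begin
      s *ₗ (x +ᴹ -ᴹ y)        ≈⟨ *ₗ-distribˡ s x (-ᴹ y) ⟩
      s *ₗ x +ᴹ s *ₗ (-ᴹ y)   ≈⟨ +ᴹ-congˡ (*ₗ-neg s y) ⟩
      s *ₗ x +ᴹ -ᴹ (s *ₗ y)   ≈⟨ +ᴹ-congˡ (-ᴹ‿cong (*ₗ-congʳ s≈t)) ⟩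
      s *ₗ x +ᴹ -ᴹ (t *ₗ y)   ∎) (*ₗ-closed s x∼y)

    ∼-neg-cong : ∀ {x y} → x ∼ y → (-ᴹ x) ∼ (-ᴹ y)
    ∼-neg-cong {x} {y} x∼y = ≈-closed (≈ᴹ-sym (⁻¹-∙-comm x (-ᴹ y))) (neg-closed x∼y)

  infixr 6 _⊕_
  _⊕_ : ∀ {m ℓm m′ ℓm′} → Module R m ℓm → Module R m′ ℓm′ → Module R (m ⊔ m′) (ℓm ⊔ ℓm′)
  M ⊕ N = DirectProduct.⟨module⟩ M N

  ⨁ : ∀ {m ℓm} (n : ℕ) → (Fin n → Module R m ℓm) → Module R m ℓm
  ⨁ zero    M = Zero.⟨module⟩
  ⨁ (suc n) M = M zero ⊕ ⨁ n (M ∘ suc)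

  infix 4 _≅_
  _≅_ : ∀ {m ℓm m′ ℓm′} → Module R m ℓm → Module R m′ ℓm′ → Set _
  M ≅ N = ∃ (ModuleMorphisms.IsModuleIsomorphism (Module.rawModule M) (Module.rawModule N))

  -- Over an integral domain, torsion means annihilated by a nonzero scalar.
  IsTorsion : ∀ {m ℓm} → Module R m ℓm → Set _
  IsTorsion M = ∀ x → ∃[ s ] ¬ (s ≈ 0#) × s *ₗ x ≈ᴹ 0ᴹ
    where
    open CommutativeRing R using (_≈_; 0#)
    open Module M

------------------------------------------------------------------------
-- Ideals

module _ {c ℓ : Level} (O : CommutativeRing c ℓ) where

  O¹ : Module O c ℓ
  O¹ = TensorUnit.⟨module⟩

  O² : Module O c ℓ
  O² = O¹ ⊕ O¹

  -- Working at predicate level c ⊔ ℓ keeps ideals closed under Span, hence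
  -- under all the operations below.
  Ideal : Set (lsuc (c ⊔ ℓ))
  Ideal = Submodule O¹ (c ⊔ ℓ)

module _ {c ℓ : Level} {O : CommutativeRing c ℓ} where
  open CommutativeRing O hiding (zero)

  ⟨_⟩ : Carrier → Ideal O
  ⟨ a ⟩ = Span (λ x → x ≈ a)

  infixl 6 _+ᴵ_
  infixl 7 _·ᴵ_
  infixr 8 _^ᴵ_

  _+ᴵ_ : Ideal O → Ideal O → Ideal O
  I +ᴵ J = Span (λ x → x ∈ I ⊎ x ∈ J)

  _·ᴵ_ : Ideal O → Ideal O → Ideal O
  I ·ᴵ J = Span (λ x → ∃[ a ] ∃[ b ] a ∈ I × b ∈ J × x ≈ a * b)

  _^ᴵ_ : Ideal O → ℕ → Ideal O
  I ^ᴵ zero  = ⟨ 1# ⟩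
  I ^ᴵ suc n = I ·ᴵ I ^ᴵ n

  ∏ᴵ : (n : ℕ) → (Fin n → Ideal O) → Ideal O
  ∏ᴵ zero    I = ⟨ 1# ⟩
  ∏ᴵ (suc n) I = I zero ·ᴵ ∏ᴵ n (I ∘ suc)

  IsPrime : Ideal O → Set (c ⊔ ℓ)
  IsPrime P = Proper P × (∀ x y → x * y ∈ P → x ∈ P ⊎ y ∈ P)

  IsMaximal : Ideal O → Set (lsuc (c ⊔ ℓ))
  IsMaximal P = Proper P × (∀ (J : Ideal O) → Proper J → P ⊆ J → J ⊆ P)

------------------------------------------------------------------------
-- Dedekind domains

module _ {c ℓ : Level} (O : CommutativeRing c ℓ) where
  open CommutativeRing O hiding (zero)

  record IsIntegralDomain : Set (c ⊔ ℓ) where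
    field
      1≉0            : ¬ (1# ≈ 0#)
      noZeroDivisors : ∀ {x y} → x * y ≈ 0# → x ≈ 0# ⊎ y ≈ 0#

  module FractionField (isDomain : IsIntegralDomain) where
    open IsIntegralDomain isDomain

    record Frac : Set (c ⊔ ℓ) where
      field
        num   : Carrier
        den   : Carrier
        den≉0 : ¬ (den ≈ 0#)

    open Frac

    private
      *-≉0 : ∀ {x y} → ¬ (x ≈ 0#) → ¬ (y ≈ 0#) → ¬ (x * y ≈ 0#)
      *-≉0 x≉0 y≉0 xy≈0 with noZeroDivisors xy≈0
      ... | inj₁ x≈0 = x≉0 x≈0
      ... | inj₂ y≈0 = y≉0 y≈0

    infix 4 _≈ᶠ_
    infixl 6 _+ᶠ_
    infixl 7 _*ᶠ_

    _≈ᶠ_ : Frac → Frac → Set ℓ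
    x ≈ᶠ y = num x * den y ≈ num y * den x

    _+ᶠ_ : Frac → Frac → Frac
    x +ᶠ y = record
      { num = num x * den y + num y * den x
      ; den = den x * den y
      ; den≉0 = *-≉0 (den≉0 x) (den≉0 y) }

    _*ᶠ_ : Frac → Frac → Frac
    x *ᶠ y = record
      { num = num x * num y
      ; den = den x * den y
      ; den≉0 = *-≉0 (den≉0 x) (den≉0 y) }

    ι : Carrier → Frac
    ι x = record { num = x ; den = 1# ; den≉0 = 1≉0 }

    -- Horner evaluation at z of the monic polynomial whose non-leading
    -- coefficients, from highest to lowest degree, are cs.
    evalMonic : List Carrier → Frac → Frac
    evalMonic cs z = foldl (λ acc a → acc *ᶠ z +ᶠ ι a) (ι 1#) cs

    IsIntegral : Frac → Set (c ⊔ ℓ)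
    IsIntegral z = ∃[ cs ] evalMonic cs z ≈ᶠ ι 0#

    IsIntegrallyClosed : Set (c ⊔ ℓ)
    IsIntegrallyClosed = ∀ z → IsIntegral z → ∃[ x ] z ≈ᶠ ι x

  record IsDedekindDomain : Set (lsuc (c ⊔ ℓ)) where
    field
      isIntegralDomain   : IsIntegralDomain
      noetherian         : (I : Ideal O) → FinitelyGenerated I
      isIntegrallyClosed : FractionField.IsIntegrallyClosed isIntegralDomain
      dimension≤1        : (P : Ideal O) → Nonzero P → IsPrime P → IsMaximal P

------------------------------------------------------------------------
-- The projective line over O modulo an ideal

module _ {c ℓ : Level} (O : CommutativeRing c ℓ) where
  open CommutativeRing O hiding (zero)

  record UnimodularPair : Set (c ⊔ ℓ) where
    field
      a b        : Carrier
      unimodular : ∀ x → x ∈ ⟨_⟩ {O = O} a +ᴵ ⟨ b ⟩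

module _ {c ℓ : Level} {O : CommutativeRing c ℓ} where
  open CommutativeRing O hiding (zero)
  open UnimodularPair

  colon : Ideal O → Carrier → Ideal O
  colon I w = record
    { member    = λ x → (x * w) ∈ I
    ; ≈-closed  = λ x≈y → ≈-closed (*-congʳ x≈y)
    ; 0-closed  = ≈-closed (sym (zeroˡ w)) 0-closed
    ; +-closed  = λ {x} {y} xw yw → ≈-closed (sym (distribʳ w x y)) (+-closed xw yw)
    ; *ₗ-closed = λ s {x} xw → ≈-closed (sym (*-assoc s x w)) (*ₗ-closed s xw)
    }
    where open Submodule I

  PF¹ : Ideal O → Setoid (c ⊔ ℓ) (c ⊔ ℓ)
  PF¹ I = record
    { Carrier = UnimodularPair O
    ; _≈_ = _∼_
    ; isEquivalence = record
      { refl  = λ {p} → ∼-refl p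
      ; sym   = λ {p} {q} → ∼-sym p q
      ; trans = λ {p} {q} {r} → ∼-trans p q r
      }
    }
    where
    open Submodule I
    open SemiringSolver commutativeSemiring
      using (solve; con; _:=_; _:+_; _:*_)
    open RingProperties ring using (-1*x≈-x)
    open AbelianGroupProperties +-abelianGroup using (⁻¹-anti-homo-//)
    open SetoidReasoning setoid

    _∼_ : UnimodularPair O → UnimodularPair O → Set (c ⊔ ℓ)
    p ∼ q = (a p * b q - b p * a q) ∈ I

    ∼-refl : ∀ p → p ∼ p
    ∼-refl p = ≈-closed
      (sym (trans (+-congˡ (-‿cong (*-comm (b p) (a p)))) (-‿inverseʳ (a p * b p))))
      0-closed

    ∼-sym : ∀ p q → p ∼ q → q ∼ p
    ∼-sym p q p∼q = ≈-closed
      (trans (-1*x≈-x _) (trans (⁻¹-anti-homo-// (a p * b q) (b p * a q))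
        (+-cong (*-comm (b p) (a q)) (-‿cong (*-comm (a p) (b q))))))
      (*ₗ-closed (- 1#) p∼q)

    -- The solver is run with an opaque o in place of - 1#.
    expand : ∀ x y z w → x * y - z * w ≈ x * y + - 1# * (z * w)
    expand x y z w = +-congˡ (sym (-1*x≈-x (z * w)))

    cancel : ∀ x y → x + (1# + - 1#) * y ≈ x
    cancel x y = trans
      (+-congˡ (trans (*-congʳ (-‿inverseʳ 1#)) (zeroˡ y))) (+-identityʳ x)

    ∼-trans : ∀ p q r → p ∼ q → q ∼ r → p ∼ r
    ∼-trans p q r p∼q q∼r = ≈-closed (*-identityˡ w) (q-kills (unimodular q 1#))
      where
      w : Carrier
      w = a p * b r - b p * a r

      a-kills : (a q * w) ∈ I
      a-kills = ≈-closed
        (begin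
          a p * (a q * b r - b q * a r) + a r * (a p * b q - b p * a q)
            ≈⟨ +-cong (*-congˡ (expand _ _ _ _)) (*-congˡ (expand _ _ _ _)) ⟩
          a p * (a q * b r + - 1# * (b q * a r)) + a r * (a p * b q + - 1# * (b p * a q))
            ≈⟨ solve 7 (λ o x y z t u v →
                 (x :* (z :* v :+ o :* (t :* u)) :+ u :* (x :* t :+ o :* (y :* z)))
                   := (z :* (x :* v :+ o :* (y :* u)) :+ (con 1 :+ o) :* (x :* t :* u)))
                 refl (- 1#) (a p) (b p) (a q) (b q) (a r) (b r) ⟩
          a q * (a p * b r + - 1# * (b p * a r)) + (1# + - 1#) * (a p * b q * a r)
            ≈⟨ cancel _ _ ⟩
          a q * (a p * b r + - 1# * (b p * a r))
            ≈⟨ *-congˡ (expand _ _ _ _) ⟨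
          a q * w ∎)
        (+-closed (*ₗ-closed (a p) q∼r) (*ₗ-closed (a r) p∼q))

      b-kills : (b q * w) ∈ I
      b-kills = ≈-closed
        (begin
          b r * (a p * b q - b p * a q) + b p * (a q * b r - b q * a r)
            ≈⟨ +-cong (*-congˡ (expand _ _ _ _)) (*-congˡ (expand _ _ _ _)) ⟩
          b r * (a p * b q + - 1# * (b p * a q)) + b p * (a q * b r + - 1# * (b q * a r))
            ≈⟨ solve 7 (λ o x y z t u v →
                 (v :* (x :* t :+ o :* (y :* z)) :+ y :* (z :* v :+ o :* (t :* u)))
                   := (t :* (x :* v :+ o :* (y :* u)) :+ (con 1 :+ o) :* (y :* z :* v)))
                 refl (- 1#) (a p) (b p) (a q) (b q) (a r) (b r) ⟩
          b q * (a p * b r + - 1# * (b p * a r)) + (1# + - 1#) * (b p * a q * b r)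
            ≈⟨ cancel _ _ ⟩
          b q * (a p * b r + - 1# * (b p * a r))
            ≈⟨ *-congˡ (expand _ _ _ _) ⟨
          b q * w ∎)
        (+-closed (*ₗ-closed (b r) p∼q) (*ₗ-closed (b p) q∼r))

      principal : ∀ {z} → (z * w) ∈ I → ⟨ z ⟩ ⊆ colon I w
      principal zw = Span-least (colon I w) λ x≈z → ≈-closed (*-congʳ (sym x≈z)) zw

      q-kills : ⟨ a q ⟩ +ᴵ ⟨ b q ⟩ ⊆ colon I w
      q-kills = Span-least (colon I w) λ
        { (inj₁ x∈) → principal a-kills x∈
        ; (inj₂ x∈) → principal b-kills x∈ }

------------------------------------------------------------------------
-- Invariants of a co-torsion submodule of O²

module _ {c ℓ : Level} {O : CommutativeRing c ℓ} where
  open CommutativeRing O hiding (zero)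
  open UnimodularPair

  IsCotorsion : Submodule (O² O) (c ⊔ ℓ) → Set (c ⊔ ℓ)
  IsCotorsion M = IsTorsion (O² O / M)

  record ElementaryDivisors (M : Submodule (O² O) (c ⊔ ℓ)) : Set (lsuc (c ⊔ ℓ)) where
    field
      r         : ℕ
      𝓜         : Fin r → Ideal O
      l k       : Fin r → ℕ
      𝓜-maximal : ∀ i → IsMaximal (𝓜 i)
      𝓜-distinct : ∀ i j → i ≢ j → ¬ (𝓜 i ≐ 𝓜 j)
      l≤k       : ∀ i → l i ℕ.≤ k i
      k≢0       : ∀ i → k i ≢ 0
      quotient≅ : O² O / M ≅ ⨁ r (λ i → (O¹ O / 𝓜 i ^ᴵ l i) ⊕ (O¹ O / 𝓜 i ^ᴵ k i))

    𝓛 : Ideal O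
    𝓛 = ∏ᴵ r (λ i → 𝓜 i ^ᴵ l i)

    𝓚 : Ideal O
    𝓚 = ∏ᴵ r (λ i → 𝓜 i ^ᴵ k i)

    𝓘 : Ideal O
    𝓘 = ∏ᴵ r (λ i → 𝓜 i ^ᴵ (k i ℕ.∸ l i))

    -- p represents the projective space invariant element of M in PF¹ 𝓘; the
    -- witnessing pair q need only lie in the class of p.
    IsProjectiveInvariant : UnimodularPair O → Set (c ⊔ ℓ)
    IsProjectiveInvariant p =
      ∃[ q ] Setoid._≈_ (PF¹ 𝓘) q p ×
        (∃[ t ] t ∈ 𝓛 × (∀ i → t ∉ 𝓛 ·ᴵ 𝓜 i) × (t * a q , t * b q) ∈ M)

{-# OPTIONS --safe #-}
module Submission where

-- Write 1 = ra + sb. Then (a , b) and (- s , r) form a basis of O², and M is the direct sum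
-- L(a , b) ⊕ K(- s , r), so that O²/M ≅ O/L ⊕ O/K. Factoring L and I simultaneously over
-- distinct maximal ideals 𝓜ᵢ as ∏ 𝓜ᵢ^lᵢ and ∏ 𝓜ᵢ^eᵢ gives K = ∏ 𝓜ᵢ^(lᵢ + eᵢ), and the
-- Chinese remainder theorem splits the quotient. Every t ∈ L outside all L𝓜ᵢ has
-- t(a , b) ∈ M; such a t exists because the 𝓜ᵢ are comaximal and L ≠ L𝓜ᵢ.
--
-- For the factorisation, every maximal P and 0 ≠ x ∈ P admit y ∉ xO with yP ⊆ xO. The fraction
-- y/x is not integral, so it stabilises no nonzero ideal. Hence P + (y/x)P = O, which gives
-- I = P(I : P) for 0 ≠ I ⊆ P, with I : P strictly larger than I; and L ≠ LP for L ≠ 0.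

open import Level using (Level; _⊔_; Lift; lift; lower) renaming (suc to lsuc)
open import Algebra.Bundles using (CommutativeRing; CommutativeMonoid)
import Algebra.Properties.AbelianGroup as AbelianGroupProperties
import Algebra.Properties.CommutativeSemigroup as CommutativeSemigroupProperties
import Algebra.Properties.Ring as RingProperties
import Algebra.Solver.Ring.NaturalCoefficients.Default as SemiringSolver
open import Algebra.Module.Bundles using (Module)
open import Algebra.Module.Morphism.Structures using (module ModuleMorphisms)
open import Axiom.ExcludedMiddle using (ExcludedMiddle)
open import Data.Fin.Base using (Fin; zero; suc)
open import Data.Fin.Properties using (suc-injective)
open import Data.List.Base using (List; []; _∷_; foldl; length)
open import Data.Nat.Base as ℕ using (ℕ; zero; suc)
import Data.Nat.Properties as ℕ
open import Data.Product using (Σ-syntax; ∃; ∃-syntax; _×_; _,_; proj₁; proj₂; swap)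
open import Data.Sum using (_⊎_; inj₁; inj₂; [_,_]′)
open import Function.Base using (_∘_; id)
open import Induction.WellFounded using (WellFounded; Acc; acc; module All)
import Relation.Binary.Construct.On as On
open import Relation.Binary.Bundles using (Setoid)
open import Relation.Binary.PropositionalEquality as ≡ using (_≡_; _≢_)
import Relation.Binary.Reasoning.Setoid as SetoidReasoning
open import Relation.Nullary using (yes; no; ¬_; contradiction)
open import Relation.Nullary.Decidable using (map′; decidable-stable)
open import Defs

lower-excludedMiddle : ∀ {a} b → ExcludedMiddle (a ⊔ b) → ExcludedMiddle a
lower-excludedMiddle b em = map′ lower lift (em {Lift b _})

-- Arithmetic of ideals

module _ {c ℓ : Level} {O : CommutativeRing c ℓ} where
  open CommutativeRing O hiding (zero)
  open SetoidReasoning setoid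
  open SemiringSolver commutativeSemiring using (solve; con; _:=_; _:+_; _:*_)
  open Submodule

  *-closedʳ : (I : Ideal O) → ∀ {x} → x ∈ I → ∀ s → x * s ∈ I
  *-closedʳ I x∈I s = ≈-closed I (*-comm s _) (*ₗ-closed I s x∈I)

  neg-closed : (I : Ideal O) → ∀ {x} → x ∈ I → - x ∈ I
  neg-closed I x∈I = ≈-closed I (RingProperties.-1*x≈-x ring _) (*ₗ-closed I (- 1#) x∈I)

  +-cancelʳ-∈ : (I : Ideal O) → ∀ {x y} → x + y ∈ I → y ∈ I → x ∈ I
  +-cancelʳ-∈ I {x} {y} x+y∈I y∈I = ≈-closed I
    (begin
      x + y + - y    ≈⟨ +-assoc x y (- y) ⟩
      x + (y + - y)  ≈⟨ +-congˡ (-‿inverseʳ y) ⟩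
      x + 0#         ≈⟨ +-identityʳ x ⟩
      x              ∎)
    (+-closed I x+y∈I (neg-closed I y∈I))

  ≐-refl : {I : Ideal O} → I ≐ I
  ≐-refl = id , id

  ≐-trans : {I J K : Ideal O} → I ≐ J → J ≐ K → I ≐ K
  ≐-trans (I⊆J , J⊆I) (J⊆K , K⊆J) = J⊆K ∘ I⊆J , J⊆I ∘ K⊆J

  a∈⟨a⟩ : ∀ a → a ∈ ⟨_⟩ {O = O} a
  a∈⟨a⟩ a = generator refl

  -- Membership in a `Span` is a derivation that exposes no coefficient. Mapping `⟨ a ⟩` into this
  -- explicit ideal by `Span-least` extracts one; `sum` does the same for `_+ᴵ_`.
  multiples : Carrier → Ideal O
  multiples a = record
    { member    = λ x → ∃[ r ] Lift c (x ≈ r * a)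
    ; ≈-closed  = λ x≈y (r , lift x≈) → r , lift (trans (sym x≈y) x≈)
    ; 0-closed  = 0# , lift (sym (zeroˡ a))
    ; +-closed  = λ (r , lift x≈) (s , lift y≈) →
        r + s , lift (trans (+-cong x≈ y≈) (sym (distribʳ a r s)))
    ; *ₗ-closed = λ t (r , lift x≈) → t * r , lift (trans (*-congˡ x≈) (sym (*-assoc t r a)))
    }

  ∈⟨⟩⇒multiple : ∀ {a x} → x ∈ ⟨_⟩ {O = O} a → ∃[ r ] x ≈ r * a
  ∈⟨⟩⇒multiple {a} x∈ with r , lift x≈ ←
    Span-least (multiples a) (λ x≈a → 1# , lift (trans x≈a (sym (*-identityˡ a)))) x∈ = r , x≈

  multiple⇒∈⟨⟩ : ∀ {a x} r → x ≈ r * a → x ∈ ⟨_⟩ {O = O} a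
  multiple⇒∈⟨⟩ r x≈ = ≈-span (sym x≈) (*ₗ-span r (generator refl))

  sum : Ideal O → Ideal O → Ideal O
  sum I J = record
    { member    = λ x → ∃[ i ] ∃[ j ] i ∈ I × j ∈ J × x ≈ i + j
    ; ≈-closed  = λ x≈y (i , j , i∈ , j∈ , x≈) → i , j , i∈ , j∈ , trans (sym x≈y) x≈
    ; 0-closed  = 0# , 0# , 0-closed I , 0-closed J , sym (+-identityʳ 0#)
    ; +-closed  = λ (i , j , i∈ , j∈ , x≈) (i′ , j′ , i′∈ , j′∈ , y≈) →
        i + i′ , j + j′ , +-closed I i∈ i′∈ , +-closed J j∈ j′∈ ,
        trans (+-cong x≈ y≈) (solve 4 (λ p q r s → (p :+ q) :+ (r :+ s) := (p :+ r) :+ (q :+ s)) refl i j i′ j′)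
    ; *ₗ-closed = λ s (i , j , i∈ , j∈ , x≈) →
        s * i , s * j , *ₗ-closed I s i∈ , *ₗ-closed J s j∈ , trans (*-congˡ x≈) (distribˡ s i j)
    }

  ⊆-sumˡ : (I J : Ideal O) → I ⊆ sum I J
  ⊆-sumˡ I J x∈I = _ , 0# , x∈I , 0-closed J , sym (+-identityʳ _)

  ⊆-sumʳ : (I J : Ideal O) → J ⊆ sum I J
  ⊆-sumʳ I J x∈J = 0# , _ , 0-closed I , x∈J , sym (+-identityˡ _)

  +ᴵ⊆sum : (I J : Ideal O) → I +ᴵ J ⊆ sum I J
  +ᴵ⊆sum I J = Span-least (sum I J) [ ⊆-sumˡ I J , ⊆-sumʳ I J ]′

  ·-intro : (I J : Ideal O) → ∀ {x y} → x ∈ I → y ∈ J → x * y ∈ I ·ᴵ J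
  ·-intro I J x∈I y∈J = generator (_ , _ , x∈I , y∈J , refl)

  ·-least : (I J N : Ideal O) → (∀ {x y} → x ∈ I → y ∈ J → x * y ∈ N) → I ·ᴵ J ⊆ N
  ·-least I J N f = Span-least N λ (_ , _ , x∈I , y∈J , z≈) → ≈-closed N (sym z≈) (f x∈I y∈J)

  ·⊆ˡ : (I J : Ideal O) → I ·ᴵ J ⊆ I
  ·⊆ˡ I J = ·-least I J I λ x∈I _ → *-closedʳ I x∈I _

  ·⊆ʳ : (I J : Ideal O) → I ·ᴵ J ⊆ J
  ·⊆ʳ I J = ·-least I J J λ _ y∈J → *ₗ-closed J _ y∈J

  ·-mono : {I I′ J J′ : Ideal O} → I ⊆ I′ → J ⊆ J′ → I ·ᴵ J ⊆ I′ ·ᴵ J′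
  ·-mono {I} {I′} {J} {J′} f g = ·-least I J (I′ ·ᴵ J′) λ x∈ y∈ → ·-intro I′ J′ (f x∈) (g y∈)

  ·-cong : {I I′ J J′ : Ideal O} → I ≐ I′ → J ≐ J′ → I ·ᴵ J ≐ I′ ·ᴵ J′
  ·-cong {I} {I′} {J} {J′} (f , f′) (g , g′) =
    ·-mono {I} {I′} {J} {J′} f g , ·-mono {I′} {I} {J′} {J} f′ g′

  ·-comm-⊆ : (I J : Ideal O) → I ·ᴵ J ⊆ J ·ᴵ I
  ·-comm-⊆ I J = ·-least I J (J ·ᴵ I) λ x∈ y∈ → ≈-closed (J ·ᴵ I) (*-comm _ _) (·-intro J I y∈ x∈)

  -- The products are taken apart one at a time: for fixed `k`, the elements that `k` multiplies
  -- into `N` form the ideal `colon N k`, so the inner induction can target it.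
  ·-assoc-⊆ : (I J K : Ideal O) → (I ·ᴵ J) ·ᴵ K ⊆ I ·ᴵ (J ·ᴵ K)
  ·-assoc-⊆ I J K = ·-least (I ·ᴵ J) K N λ {_} {k} u∈ k∈ →
    ·-least I J (colon N k)
      (λ x∈ y∈ → ≈-closed N (sym (*-assoc _ _ _)) (·-intro I (J ·ᴵ K) x∈ (·-intro J K y∈ k∈))) u∈
    where N = I ·ᴵ (J ·ᴵ K)

  ·-assoc-⊇ : (I J K : Ideal O) → I ·ᴵ (J ·ᴵ K) ⊆ (I ·ᴵ J) ·ᴵ K
  ·-assoc-⊇ I J K = ·-least I (J ·ᴵ K) N λ {i} i∈ v∈ → ≈-closed N (*-comm _ i)
    (·-least J K (colon N i)
      (λ x∈ y∈ → ≈-closed N (trans (*-assoc _ _ _) (*-comm i _)) (·-intro (I ·ᴵ J) K (·-intro I J i∈ x∈) y∈)) v∈)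
    where N = (I ·ᴵ J) ·ᴵ K

  ·-identityʳ : (I : Ideal O) → I ·ᴵ ⟨ 1# ⟩ ≐ I
  ·-identityʳ I = ·⊆ˡ I ⟨ 1# ⟩ ,
    λ x∈ → ≈-closed (I ·ᴵ ⟨ 1# ⟩) (*-identityʳ _) (·-intro I ⟨ 1# ⟩ x∈ (a∈⟨a⟩ 1#))

  ·-identityˡ : (I : Ideal O) → ⟨ 1# ⟩ ·ᴵ I ≐ I
  ·-identityˡ I = ·⊆ʳ ⟨ 1# ⟩ I ,
    λ x∈ → ≈-closed (⟨ 1# ⟩ ·ᴵ I) (*-identityˡ _) (·-intro ⟨ 1# ⟩ I (a∈⟨a⟩ 1#) x∈)

  ideals : CommutativeMonoid (lsuc (c ⊔ ℓ)) (c ⊔ ℓ)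
  ideals = record
    { Carrier = Ideal O ; _≈_ = _≐_ ; _∙_ = _·ᴵ_ ; ε = ⟨ 1# ⟩
    ; isCommutativeMonoid = record
      { isMonoid = record
        { isSemigroup = record
          { isMagma = record
            { isEquivalence = record
              { refl  = λ {I} → ≐-refl {I}
              ; sym   = swap
              ; trans = λ {I} {J} {K} → ≐-trans {I} {J} {K}
              }
            ; ∙-cong = λ {I} {I′} {J} {J′} → ·-cong {I} {I′} {J} {J′}
            }
          ; assoc = λ I J K → ·-assoc-⊆ I J K , ·-assoc-⊇ I J K
          }
        ; identity = ·-identityˡ , ·-identityʳ
        }
      ; comm = λ I J → ·-comm-⊆ I J , ·-comm-⊆ J I
      }
    }

  ∏-cong : ∀ n {A B : Fin n → Ideal O} → (∀ i → A i ≐ B i) → ∏ᴵ n A ≐ ∏ᴵ n B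
  ∏-cong zero    A≐B = ≐-refl {⟨ 1# ⟩}
  ∏-cong (suc n) {A} {B} A≐B = ·-cong {A zero} {B zero} {∏ᴵ n (A ∘ suc)} {∏ᴵ n (B ∘ suc)}
    (A≐B zero) (∏-cong n (A≐B ∘ suc))

  ∏⊆ : ∀ n (A : Fin n → Ideal O) i → ∏ᴵ n A ⊆ A i
  ∏⊆ (suc n) A zero    = ·⊆ˡ (A zero) (∏ᴵ n (A ∘ suc))
  ∏⊆ (suc n) A (suc i) = ∏⊆ n (A ∘ suc) i ∘ ·⊆ʳ (A zero) (∏ᴵ n (A ∘ suc))

  open CommutativeMonoid ideals using (commutativeSemigroup)
    renaming (setoid to ≐-setoid; assoc to ·-assoc; ∙-congˡ to ·-congˡ)
  open CommutativeSemigroupProperties commutativeSemigroup using (interchange; x∙yz≈y∙xz)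
  module ≐-Reasoning = SetoidReasoning ≐-setoid

  ^-+ : ∀ (P : Ideal O) m n → P ^ᴵ (m ℕ.+ n) ≐ P ^ᴵ m ·ᴵ P ^ᴵ n
  ^-+ P zero    n = swap (·-identityˡ (P ^ᴵ n))
  ^-+ P (suc m) n = ≐R.begin
    P ·ᴵ P ^ᴵ (m ℕ.+ n)         ≐R.≈⟨ ·-congˡ {P} {P ^ᴵ (m ℕ.+ n)} {P ^ᴵ m ·ᴵ P ^ᴵ n} (^-+ P m n) ⟩
    P ·ᴵ (P ^ᴵ m ·ᴵ P ^ᴵ n)     ≐R.≈⟨ ·-assoc P (P ^ᴵ m) (P ^ᴵ n) ⟨
    P ·ᴵ P ^ᴵ m ·ᴵ P ^ᴵ n       ≐R.∎
    where module ≐R = ≐-Reasoning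

  ∏-· : ∀ n (A B : Fin n → Ideal O) → ∏ᴵ n (λ i → A i ·ᴵ B i) ≐ ∏ᴵ n A ·ᴵ ∏ᴵ n B
  ∏-· zero    A B = swap (·-identityˡ ⟨ 1# ⟩)
  ∏-· (suc n) A B = ≐R.begin
    A₀ ·ᴵ B₀ ·ᴵ ∏ᴵ n (λ i → A (suc i) ·ᴵ B (suc i))
      ≐R.≈⟨ ·-congˡ {A₀ ·ᴵ B₀} {∏ᴵ n (λ i → A (suc i) ·ᴵ B (suc i))} {As ·ᴵ Bs} (∏-· n (A ∘ suc) (B ∘ suc)) ⟩
    A₀ ·ᴵ B₀ ·ᴵ (As ·ᴵ Bs)
      ≐R.≈⟨ interchange A₀ B₀ As Bs ⟩
    A₀ ·ᴵ As ·ᴵ (B₀ ·ᴵ Bs)  ≐R.∎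
    where
    module ≐R = ≐-Reasoning
    A₀ = A zero
    B₀ = B zero
    As = ∏ᴵ n (A ∘ suc)
    Bs = ∏ᴵ n (B ∘ suc)

  -- Exponents in products of ideal powers.

  increment : ∀ {n} → Fin n → (Fin n → ℕ) → Fin n → ℕ
  increment zero    l zero    = suc (l zero)
  increment zero    l (suc j) = l (suc j)
  increment (suc i) l zero    = l zero
  increment (suc i) l (suc j) = increment i (l ∘ suc) j

  ≤-increment : ∀ {n} (i : Fin n) l j → l j ℕ.≤ increment i l j
  ≤-increment zero    l zero    = ℕ.n≤1+n (l zero)
  ≤-increment zero    l (suc j) = ℕ.≤-refl
  ≤-increment (suc i) l zero    = ℕ.≤-refl
  ≤-increment (suc i) l (suc j) = ≤-increment i (l ∘ suc) j

  ∏-increment : ∀ n (P : Fin n → Ideal O) l i →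
                ∏ᴵ n (λ j → P j ^ᴵ increment i l j) ≐ P i ·ᴵ ∏ᴵ n (λ j → P j ^ᴵ l j)
  ∏-increment (suc n) P l zero    = ·-assoc (P zero) (P zero ^ᴵ l zero) (∏ᴵ n (λ j → P (suc j) ^ᴵ l (suc j)))
  ∏-increment (suc n) P l (suc i) = ≐R.begin
    P₀ ·ᴵ ∏ᴵ n (λ j → P (suc j) ^ᴵ increment i (l ∘ suc) j)
      ≐R.≈⟨ ·-congˡ {P₀} {∏ᴵ n (λ j → P (suc j) ^ᴵ increment i (l ∘ suc) j)} {P (suc i) ·ᴵ Ps}
              (∏-increment n (P ∘ suc) (l ∘ suc) i) ⟩
    P₀ ·ᴵ (P (suc i) ·ᴵ Ps)
      ≐R.≈⟨ x∙yz≈y∙xz P₀ (P (suc i)) Ps ⟩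
    P (suc i) ·ᴵ (P₀ ·ᴵ Ps)  ≐R.∎
    where
    module ≐R = ≐-Reasoning
    P₀ = P zero ^ᴵ l zero
    Ps = ∏ᴵ n (λ j → P (suc j) ^ᴵ l (suc j))

  -- Comaximal ideals

  Comaximal : Ideal O → Ideal O → Set (c ⊔ ℓ)
  Comaximal A B = ∃[ a ] ∃[ b ] a ∈ A × b ∈ B × 1# ≈ a + b

  comaximal-sym : {A B : Ideal O} → Comaximal A B → Comaximal B A
  comaximal-sym (a , b , a∈ , b∈ , 1≈) = b , a , b∈ , a∈ , trans 1≈ (+-comm a b)

  comaximal-1 : (A : Ideal O) → Comaximal A ⟨ 1# ⟩
  comaximal-1 A = 0# , 1# , 0-closed A , a∈⟨a⟩ 1# , sym (+-identityˡ 1#)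

  -- Multiply the two decompositions of `1#`: every term except `b * d` has a factor in `A`.
  comaximal-· : (A B C : Ideal O) → Comaximal A B → Comaximal A C → Comaximal A (B ·ᴵ C)
  comaximal-· A B C (a , b , a∈ , b∈ , 1≈) (a′ , d , a′∈ , d∈ , 1≈′) =
    a * a′ + a * d + b * a′ , b * d ,
    +-closed A (+-closed A (*-closedʳ A a∈ a′) (*-closedʳ A a∈ d)) (*ₗ-closed A b a′∈) ,
    ·-intro B C b∈ d∈ ,
    (begin
      1#                     ≈⟨ *-identityˡ 1# ⟨
      1# * 1#                ≈⟨ *-cong 1≈ 1≈′ ⟩
      (a + b) * (a′ + d)     ≈⟨ solve 4 (λ a b a′ d → (a :+ b) :* (a′ :+ d) :=
                                 (a :* a′ :+ a :* d :+ b :* a′) :+ b :* d) refl a b a′ d ⟩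
      a * a′ + a * d + b * a′ + b * d  ∎)

  comaximal-^ : (A B : Ideal O) → Comaximal A B → ∀ n → Comaximal A (B ^ᴵ n)
  comaximal-^ A B A⊥B zero    = comaximal-1 A
  comaximal-^ A B A⊥B (suc n) = comaximal-· A B (B ^ᴵ n) A⊥B (comaximal-^ A B A⊥B n)

  comaximal-∏ : ∀ (A : Ideal O) n (B : Fin n → Ideal O) → (∀ i → Comaximal A (B i)) → Comaximal A (∏ᴵ n B)
  comaximal-∏ A zero    B A⊥B = comaximal-1 A
  comaximal-∏ A (suc n) B A⊥B =
    comaximal-· A (B zero) (∏ᴵ n (B ∘ suc)) (A⊥B zero) (comaximal-∏ A n (B ∘ suc) (A⊥B ∘ suc))

  comaximal-^^ : (A B : Ideal O) → Comaximal A B → ∀ m n → Comaximal (A ^ᴵ m) (B ^ᴵ n)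
  comaximal-^^ A B A⊥B m n = comaximal-^ (A ^ᴵ m) B
    (comaximal-sym {B} {A ^ᴵ m} (comaximal-^ B A (comaximal-sym {A} {B} A⊥B) m)) n

  -- The Chinese remainder theorem and avoidance.

  Pairwise : ∀ n → (Fin n → Ideal O) → Set (c ⊔ ℓ)
  Pairwise n A = ∀ i j → i ≢ j → Comaximal (A i) (A j)

  module _ {n} {A : Fin (suc n) → Ideal O} (A⊥ : Pairwise (suc n) A) where

    pairwise-head : Comaximal (A zero) (∏ᴵ n (A ∘ suc))
    pairwise-head = comaximal-∏ (A zero) n (A ∘ suc) λ i → A⊥ zero (suc i) λ ()

    pairwise-tail : Pairwise n (A ∘ suc)
    pairwise-tail i j i≢j = A⊥ (suc i) (suc j) (i≢j ∘ suc-injective)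

  -- With `1# ≈ a + b` splitting the head from the remaining product, x = a x + x b. The first term
  -- lies in the product because `x` lies in the tail product by induction, the second because `x`
  -- lies in `A zero`.
  ∩⊆∏ : ∀ n (A : Fin n → Ideal O) → Pairwise n A → ∀ {x} → (∀ i → x ∈ A i) → x ∈ ∏ᴵ n A
  ∩⊆∏ zero    A A⊥ {x} x∈ = multiple⇒∈⟨⟩ x (sym (*-identityʳ x))
  ∩⊆∏ (suc n) A A⊥ {x} x∈ with a , b , a∈ , b∈ , 1≈ ← pairwise-head {A = A} A⊥ =
    ≈-closed N
      (begin
        a * x + x * b   ≈⟨ solve 3 (λ a b x → a :* x :+ x :* b := x :* (a :+ b)) refl a b x ⟩
        x * (a + b)     ≈⟨ *-congˡ 1≈ ⟨
        x * 1#          ≈⟨ *-identityʳ x ⟩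
        x               ∎)
      (+-closed N
        (·-intro (A zero) (∏ᴵ n (A ∘ suc)) a∈ (∩⊆∏ n (A ∘ suc) (pairwise-tail {A = A} A⊥) (x∈ ∘ suc)))
        (·-intro (A zero) (∏ᴵ n (A ∘ suc)) (x∈ zero) b∈))
    where N = A zero ·ᴵ ∏ᴵ n (A ∘ suc)

  ∈-difference : (I : Ideal O) → ∀ {x y p q r} → x ≈ p + q → y ≈ p + r → q ∈ I → r ∈ I → x - y ∈ I
  ∈-difference I {x} {y} {p} {q} {r} x≈ y≈ q∈ r∈ = ≈-closed I
    (begin
      q + - r              ≈⟨ +-congʳ (AbelianGroupProperties.xyx⁻¹≈y +-abelianGroup p q) ⟨
      p + q + - p + - r    ≈⟨ +-assoc (p + q) (- p) (- r) ⟩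
      p + q + (- p + - r)  ≈⟨ +-congˡ (AbelianGroupProperties.⁻¹-∙-comm +-abelianGroup p r) ⟩
      p + q + - (p + r)    ≈⟨ +-cong (sym x≈) (-‿cong (sym y≈)) ⟩
      x - y                ∎)
    (+-closed I q∈ (neg-closed I r∈))

  chineseRemainder : ∀ n (A : Fin n → Ideal O) → Pairwise n A →
                     ∀ (y : Fin n → Carrier) → ∃[ x ] ∀ i → x - y i ∈ A i
  chineseRemainder zero    A A⊥ y = 0# , λ ()
  chineseRemainder (suc n) A A⊥ y
    with a , b , a∈ , b∈ , 1≈ ← pairwise-head {A = A} A⊥
       | x′ , x′≡y ← chineseRemainder n (A ∘ suc) (pairwise-tail {A = A} A⊥) (y ∘ suc) = x , x≡y
    where
    -- `b` is 1 modulo `A zero` and 0 modulo every later ideal; `a` is the reverse.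
    x = y zero * b + x′ * a

    split : ∀ z → z ≈ z * b + z * a
    split z = begin
      z              ≈⟨ *-identityʳ z ⟨
      z * 1#         ≈⟨ *-congˡ 1≈ ⟩
      z * (a + b)    ≈⟨ solve 3 (λ a b z → z :* (a :+ b) := z :* b :+ z :* a) refl a b z ⟩
      z * b + z * a  ∎

    x≡y : ∀ i → x - y i ∈ A i
    x≡y zero    = ∈-difference (A zero) refl (split (y zero))
                    (*ₗ-closed (A zero) x′ a∈) (*ₗ-closed (A zero) (y zero) a∈)
    x≡y (suc i) = ≈-closed (A (suc i))
      (begin
        (x - x′) + (x′ - y (suc i))    ≈⟨ +-assoc x (- x′) (x′ - y (suc i)) ⟩
        x + (- x′ + (x′ - y (suc i)))  ≈⟨ +-congˡ (+-assoc (- x′) x′ (- y (suc i))) ⟨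
        x + (- x′ + x′ - y (suc i))    ≈⟨ +-congˡ (+-congʳ (-‿inverseˡ x′)) ⟩
        x + (0# - y (suc i))           ≈⟨ +-congˡ (+-identityˡ (- y (suc i))) ⟩
        x - y (suc i)                  ∎)
      (+-closed (A (suc i))
        (∈-difference (A (suc i)) (+-comm (y zero * b) (x′ * a))
           (trans (split x′) (+-comm (x′ * b) (x′ * a)))
           (*ₗ-closed (A (suc i)) (y zero) b∈Aᵢ) (*ₗ-closed (A (suc i)) x′ b∈Aᵢ))
        (x′≡y i))
      where b∈Aᵢ = ∏⊆ n (A ∘ suc) i b∈

  -- Modulo `L ·ᴵ P`, multiplication by `b` fixes elements of `L` and multiplication by `a` kills
  -- them, so the combination is congruent to `u`.
  ∉-combination : (L P : Ideal O) → ∀ {a b u v} → a ∈ P → 1# ≈ a + b → u ∈ L → v ∈ L →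
                  u ∉ L ·ᴵ P → b * u + a * v ∉ L ·ᴵ P
  ∉-combination L P {a} {b} {u} {v} a∈ 1≈ u∈ v∈ u∉ t∈ = u∉ (+-cancelʳ-∈ N
    (≈-closed N
      (begin
        b * u + a * v + a * u    ≈⟨ solve 4 (λ a b u v → b :* u :+ a :* v :+ a :* u := (a :+ b) :* u :+ a :* v) refl a b u v ⟩
        (a + b) * u + a * v      ≈⟨ +-congʳ (*-congʳ 1≈) ⟨
        1# * u + a * v           ≈⟨ +-congʳ (*-identityˡ u) ⟩
        u + a * v                ∎)
      (+-closed N t∈ (a*_∈N u∈)))
    (a*_∈N v∈))
    where
    N = L ·ᴵ P
    a*_∈N : ∀ {w} → w ∈ L → a * w ∈ N
    a*_∈N w∈ = ≈-closed N (*-comm _ a) (·-intro L P w∈ a∈)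

  -- The element b w + a t′ is congruent to `w` modulo `L ·ᴵ P zero` and to `t′` modulo each later
  -- `L ·ᴵ P (suc i)`, so it inherits both avoidances.
  avoidance : ∀ (L : Ideal O) n (P : Fin n → Ideal O) → Pairwise n P →
              (∀ i → ∃[ w ] w ∈ L × w ∉ L ·ᴵ P i) → ∃[ t ] t ∈ L × (∀ i → t ∉ L ·ᴵ P i)
  avoidance L zero    P P⊥ ws = 0# , 0-closed L , λ ()
  avoidance L (suc n) P P⊥ ws
    with a , b , a∈ , b∈ , 1≈ ← pairwise-head {A = P} P⊥
       | w , w∈ , w∉ ← ws zero
       | t′ , t′∈ , t′∉ ← avoidance L n (P ∘ suc) (pairwise-tail {A = P} P⊥) (ws ∘ suc) =
    b * w + a * t′ , +-closed L (*ₗ-closed L b w∈) (*ₗ-closed L a t′∈) , λ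
    { zero    t∈ → ∉-combination L (P zero) a∈ 1≈ w∈ t′∈ w∉ t∈
    ; (suc i) t∈ → ∉-combination L (P (suc i)) (∏⊆ n (P ∘ suc) i b∈) (trans 1≈ (+-comm a b)) t′∈ w∈ (t′∉ i)
                     (≈-closed (L ·ᴵ P (suc i)) (+-comm (b * w) (a * t′)) t∈)
    }

  -- Ascending chains

  ascending : (C : ℕ → Ideal O) → (∀ n → C n ⊆ C (suc n)) → ∀ {m n} → m ℕ.≤ n → C m ⊆ C n
  ascending C up m≤n = go (ℕ.≤⇒≤′ m≤n)
    where
    go : ∀ {m n} → m ℕ.≤′ n → C m ⊆ C n
    go ℕ.≤′-refl       = id
    go (ℕ.≤′-step m≤n) = up _ ∘ go m≤n

  union : (C : ℕ → Ideal O) → (∀ n → C n ⊆ C (suc n)) → Ideal O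
  union C up = record
    { member    = λ x → ∃[ n ] x ∈ C n
    ; ≈-closed  = λ x≈y (n , x∈) → n , ≈-closed (C n) x≈y x∈
    ; 0-closed  = 0 , 0-closed (C 0)
    ; +-closed  = λ (m , x∈) (n , y∈) → m ℕ.⊔ n ,
        +-closed (C (m ℕ.⊔ n)) (ascending C up (ℕ.m≤m⊔n m n) x∈) (ascending C up (ℕ.m≤n⊔m m n) y∈)
    ; *ₗ-closed = λ s (n , x∈) → n , *ₗ-closed (C n) s x∈
    }

  common-stage : (C : ℕ → Ideal O) (up : ∀ n → C n ⊆ C (suc n)) →
                 ∀ k (v : Fin k → Carrier) → (∀ i → v i ∈ union C up) → ∃[ N ] ∀ i → v i ∈ C N
  common-stage C up zero    v v∈ = 0 , λ ()
  common-stage C up (suc k) v v∈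
    with m , v₀∈ ← v∈ zero | n , vs∈ ← common-stage C up k (v ∘ suc) (v∈ ∘ suc) =
    m ℕ.⊔ n , λ
    { zero    → ascending C up (ℕ.m≤m⊔n m n) v₀∈
    ; (suc i) → ascending C up (ℕ.m≤n⊔m m n) (vs∈ i)
    }

  module Noetherian (noetherian : (I : Ideal O) → FinitelyGenerated I) where

    -- The union of the chain is finitely generated, and finitely many generators all appear by some
    -- stage `N`.
    chain-stabilises : (C : ℕ → Ideal O) → (∀ n → C n ⊆ C (suc n)) → ∃[ N ] ∀ n → C n ⊆ C N
    chain-stabilises C up
      with k , v , U⊆ , ⊇ ← noetherian (union C up)
      with N , v∈ ← common-stage C up k v (λ i → ⊇ (generator (i , refl))) =
      N , λ n x∈ → Span-least (C N) (λ (i , x≈) → ≈-closed (C N) (sym x≈) (v∈ i)) (U⊆ (n , x∈))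

    infix 4 _⊃_
    _⊃_ : Ideal O → Ideal O → Set (c ⊔ ℓ)
    J ⊃ I = I ⊆ J × ¬ (J ⊆ I)

    -- An inaccessible ideal has a strictly larger inaccessible one, since otherwise it would be
    -- accessible. Iterating gives a strictly ascending chain, which cannot stabilise.
    ⊃-wellFounded : ExcludedMiddle (lsuc (c ⊔ ℓ)) → WellFounded _⊃_
    ⊃-wellFounded em I = decidable-stable em λ ¬acc →
      let chain       = descend (I , ¬acc)
          N , stable  = chain-stabilises (proj₁ ∘ chain) (proj₁ ∘ proj₂ ∘ next ∘ chain)
      in  proj₂ (proj₂ (next (chain N))) (stable (suc N))
      where
      Inaccessible : Set (lsuc (c ⊔ ℓ))
      Inaccessible = Σ[ J ∈ Ideal O ] ¬ Acc _⊃_ J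

      next : ((J , _) : Inaccessible) → Σ[ (K , _) ∈ Inaccessible ] K ⊃ J
      next (J , ¬acc) with em {Σ[ (K , _) ∈ Inaccessible ] K ⊃ J}
      ... | yes larger = larger
      ... | no ¬larger = contradiction
        (acc λ {K} K⊃J → decidable-stable em λ ¬accK → ¬larger ((K , ¬accK) , K⊃J)) ¬acc

      descend : Inaccessible → ℕ → Inaccessible
      descend J zero    = J
      descend J (suc n) = proj₁ (next (descend J n))

  -- Maximal ideals

  module Classical (em : ExcludedMiddle (lsuc (c ⊔ ℓ))) where

    em₀ : ExcludedMiddle (c ⊔ ℓ)
    em₀ = lower-excludedMiddle (lsuc (c ⊔ ℓ)) em

    ⊈⇒∃ : (I J : Ideal O) → ¬ (I ⊆ J) → ∃[ x ] x ∈ I × x ∉ J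
    ⊈⇒∃ I J I⊈J = decidable-stable em₀ λ ¬∃ →
      I⊈J λ {x} x∈I → decidable-stable em₀ λ x∉J → ¬∃ (x , x∈I , x∉J)

    -- If `1#` does not split, P + Q is proper, so maximality of `P` forces it, and with it `Q`,
    -- into `P`.
    maximal-comaximal : (P Q : Ideal O) → IsMaximal P → ¬ (Q ⊆ P) → Comaximal P Q
    maximal-comaximal P Q (_ , P-max) Q⊈P = decidable-stable em₀ λ P¬⊥Q →
      Q⊈P (P-max (sum P Q) (λ all → P¬⊥Q (all 1#)) (⊆-sumˡ P Q) ∘ ⊆-sumʳ P Q)

    -- Since `y` lies outside `P`, 1 = p + r y with p in `P`; multiply by `x`.
    maximal⇒prime : (P : Ideal O) → IsMaximal P → ∀ {x y} → x * y ∈ P → y ∉ P → x ∈ P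
    maximal⇒prime P P-max {x} {y} xy∈P y∉P
      with p , q , p∈ , q∈ , 1≈ ← maximal-comaximal P ⟨ y ⟩ P-max (λ ⟨y⟩⊆P → y∉P (⟨y⟩⊆P (a∈⟨a⟩ y)))
      with r , q≈ ← ∈⟨⟩⇒multiple q∈ = ≈-closed P
        (begin
          x * p + r * (x * y)   ≈⟨ solve 4 (λ x p r y → x :* p :+ r :* (x :* y) := x :* (p :+ r :* y)) refl x p r y ⟩
          x * (p + r * y)       ≈⟨ *-congˡ (+-congˡ q≈) ⟨
          x * (p + q)           ≈⟨ *-congˡ 1≈ ⟨
          x * 1#                ≈⟨ *-identityʳ x ⟩
          x                     ∎)
        (+-closed P (*ₗ-closed P x p∈) (*ₗ-closed P r xy∈P))

    distinct-maximal⇒comaximal : (P Q : Ideal O) → IsMaximal P → IsMaximal Q → ¬ (P ≐ Q) → Comaximal P Q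
    distinct-maximal⇒comaximal P Q P-max (Q-proper , Q-max) P≠Q =
      maximal-comaximal P Q P-max λ Q⊆P → P≠Q (Q-max P (proj₁ P-max) Q⊆P , Q⊆P)

  -- Dedekind domains

  module Dedekind (em : ExcludedMiddle (lsuc (c ⊔ ℓ))) (dedekind : IsDedekindDomain O) where
    open IsDedekindDomain dedekind
    open IsIntegralDomain isIntegralDomain
    open FractionField O isIntegralDomain
    open Frac
    open Noetherian noetherian
    open Classical em

    -- Integral closure and stable ideals.

    *-cancelˡ : ∀ {x y z} → ¬ (x ≈ 0#) → x * y ≈ x * z → y ≈ z
    *-cancelˡ {x} {y} {z} x≉0 xy≈xz with noZeroDivisors x[y-z]≈0
      where
      x[y-z]≈0 : x * (y - z) ≈ 0#
      x[y-z]≈0 = begin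
        x * (y - z)      ≈⟨ RingProperties.x[y-z]≈xy-xz ring x y z ⟩
        x * y - x * z    ≈⟨ +-congʳ xy≈xz ⟩
        x * z - x * z    ≈⟨ -‿inverseʳ (x * z) ⟩
        0#               ∎
    ... | inj₁ x≈0   = contradiction x≈0 x≉0
    ... | inj₂ y-z≈0 = RingProperties.x∙y⁻¹≈ε⇒x≈y ring y z y-z≈0

    -- If (y/x)J ⊆ J for some J ≠ 0 then y/x is integral: pick 0 ≠ w ∈ J; the chain of
    -- ideals generated by w, (y/x)w, …, (y/x)ⁿw stabilises, which yields a monic equation.
    module _ {x y : Carrier} (x≉0 : ¬ (x ≈ 0#)) (J : Ideal O)
             (stable : ∀ {i} → i ∈ J → ∃[ i′ ] i′ ∈ J × x * i′ ≈ y * i) where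

      y/x : Frac
      y/x = record { num = y ; den = x ; den≉0 = x≉0 }

      module _ (J≠0 : Nonzero J) where

        orbit : ℕ → ∃[ w ] w ∈ J
        orbit zero    = proj₁ J≠0 , proj₁ (proj₂ J≠0)
        orbit (suc n) = let i′ , i′∈ , _ = stable (proj₂ (orbit n)) in i′ , i′∈

        w : ℕ → Carrier
        w = proj₁ ∘ orbit

        w-step : ∀ n → x * w (suc n) ≈ y * w n
        w-step n = proj₂ (proj₂ (stable (proj₂ (orbit n))))

        -- The head coefficient goes with the highest index, matching the order of coefficients in
        -- `evalMonic`.
        combination : List Carrier → Carrier
        combination []       = 0#
        combination (a ∷ as) = a * w (length as) + combination as

        -- `Initial n` is generated by the terms of index below `n`, so stability at `N` expresses
        -- `w N` through strictly earlier terms.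
        Initial : ℕ → Ideal O
        Initial zero    = ⟨ 0# ⟩
        Initial (suc n) = sum ⟨ w n ⟩ (Initial n)

        initial⇒combination : ∀ n {e} → e ∈ Initial n → ∃[ as ] length as ≡ n × e ≈ combination as
        initial⇒combination zero    e∈ with r , e≈ ← ∈⟨⟩⇒multiple e∈ = [] , ≡.refl , trans e≈ (zeroʳ r)
        initial⇒combination (suc n) (i , j , i∈ , j∈ , e≈)
          with r , i≈ ← ∈⟨⟩⇒multiple i∈ | as , ≡.refl , j≈ ← initial⇒combination n j∈ =
          r ∷ as , ≡.refl , trans e≈ (+-cong i≈ j≈)

        -- A sequence s with x s (suc j) ≈ y s j stands for the multiples (y/x)ʲ s 0.
        horner : (ℕ → Carrier) → Carrier → ℕ → Carrier
        horner s a j = s (suc j) + a * w j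

        -- Each pass shifts the sequence by one index, which is multiplication by y/x, and adds the
        -- next coefficient. The start of `s` thus becomes its term of index `length as`, the
        -- leading term of a monic expression.
        horner-eval : ∀ as s → foldl horner s as 0 ≈ s (length as) + combination as
        horner-eval []       s = sym (+-identityʳ (s 0))
        horner-eval (a ∷ as) s = trans (horner-eval as (horner s a)) (+-assoc _ _ _)

        -- The loop invariant is f · w 0 = s 0, with denominators cleared. One Horner step preserves
        -- it, and the new sequence obeys the same recurrence.
        horner-evalMonic : ∀ as f s → (∀ j → x * s (suc j) ≈ y * s j) → num f * w 0 ≈ den f * s 0 →
                           let F = foldl (λ f a → f *ᶠ y/x +ᶠ ι a) f as in
                           num F * w 0 ≈ den F * foldl horner s as 0
        horner-evalMonic []       f s s-step fw≈s = fw≈s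
        horner-evalMonic (a ∷ as) f s s-step fw≈s =
          horner-evalMonic as (f *ᶠ y/x +ᶠ ι a) (horner s a)
            (λ j → begin
              x * (s (suc (suc j)) + a * w (suc j))
                ≈⟨ solve 4 (λ x s a w → x :* (s :+ a :* w) := x :* s :+ a :* (x :* w)) refl x (s (suc (suc j))) a (w (suc j)) ⟩
              x * s (suc (suc j)) + a * (x * w (suc j))
                ≈⟨ +-cong (s-step (suc j)) (*-congˡ (w-step j)) ⟩
              y * s (suc j) + a * (y * w j)
                ≈⟨ solve 4 (λ y s a w → y :* s :+ a :* (y :* w) := y :* (s :+ a :* w)) refl y (s (suc j)) a (w j) ⟩
              y * (s (suc j) + a * w j) ∎)
            (begin
              (num f * y * 1# + a * (den f * x)) * w 0
                ≈⟨ solve 6 (λ n d x y a w → (n :* y :* con 1 :+ a :* (d :* x)) :* w :=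
                     y :* (n :* w) :+ d :* x :* (a :* w)) refl (num f) (den f) x y a (w 0) ⟩
              y * (num f * w 0) + den f * x * (a * w 0)
                ≈⟨ +-congʳ (*-congˡ fw≈s) ⟩
              y * (den f * s 0) + den f * x * (a * w 0)
                ≈⟨ +-congʳ (solve 3 (λ y d s → y :* (d :* s) := d :* (y :* s)) refl y (den f) (s 0)) ⟩
              den f * (y * s 0) + den f * x * (a * w 0)
                ≈⟨ +-congʳ (*-congˡ (s-step 0)) ⟨
              den f * (x * s 1) + den f * x * (a * w 0)
                ≈⟨ solve 4 (λ d x s e → d :* (x :* s) :+ d :* x :* e := d :* x :* con 1 :* (s :+ e))
                     refl (den f) x (s 1) (a * w 0) ⟩
              den f * x * 1# * (s 1 + a * w 0) ∎)

        y/x-integral : IsIntegral y/x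
        y/x-integral
          with N , stabilises ← chain-stabilises Initial (λ n → ⊆-sumʳ ⟨ w n ⟩ (Initial n))
          -- The coefficients are those of `- w N`, so that `w N` plus the combination vanishes and
          -- the resulting equation is monic.
          with as , ≡.refl , -w≈ ← initial⇒combination N (neg-closed (Initial N)
                 (stabilises (suc N) (⊆-sumˡ ⟨ w N ⟩ (Initial N) (a∈⟨a⟩ (w N))))) = as , F≈0
          where
          F = evalMonic as y/x

          Fw≈0 : num F * w 0 ≈ 0#
          Fw≈0 = begin
            num F * w 0                         ≈⟨ horner-evalMonic as (ι 1#) w w-step refl ⟩
            den F * foldl horner w as 0         ≈⟨ *-congˡ (horner-eval as w) ⟩
            den F * (w (length as) + combination as)  ≈⟨ *-congˡ (+-congˡ -w≈) ⟨
            den F * (w (length as) - w (length as))   ≈⟨ *-congˡ (-‿inverseʳ _) ⟩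
            den F * 0#                          ≈⟨ zeroʳ (den F) ⟩
            0#                                  ∎

          F≈0 : F ≈ᶠ ι 0#
          F≈0 with noZeroDivisors Fw≈0
          ... | inj₁ n≈0 = trans (*-congʳ n≈0) (trans (zeroˡ 1#) (sym (zeroˡ (den F))))
          ... | inj₂ w≈0 = contradiction w≈0 (proj₂ (proj₂ J≠0))

        -- Integral closedness puts y/x in O. The contrapositive is what gets applied: a fraction
        -- outside O stabilises no nonzero ideal.
        stable⇒∈⟨⟩ : y ∈ ⟨_⟩ {O = O} x
        stable⇒∈⟨⟩ with d , y≈dx ← isIntegrallyClosed y/x y/x-integral =
          multiple⇒∈⟨⟩ d (trans (sym (*-identityʳ y)) y≈dx)

    -- The fraction y/x is an element of the inverse of `P` that lies outside O. Here x p′ = y p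
    -- expresses that (y/x)p is the ring element `p′`.
    record Escape (P : Ideal O) (x : Carrier) : Set (c ⊔ ℓ) where
      field
        y      : Carrier
        y∉⟨x⟩  : y ∉ ⟨_⟩ {O = O} x
        yP⊆xO  : ∀ {p} → p ∈ P → ∃[ p′ ] x * p′ ≈ y * p

    -- A colon ideal (x : w) that is maximal among those contained in P is prime, hence equal to P.
    escape : (P : Ideal O) → IsMaximal P → ∀ {x} → ¬ (x ≈ 0#) → x ∈ P → Escape P x
    -- The induction starts at `1#`, where the colon ideal is `⟨ x ⟩` and so lies in `P`.
    escape P P-max@(P-proper , _) {x} x≉0 x∈P = wfRec Candidate step 1# λ z∈ →
      let r , z*1≈ = ∈⟨⟩⇒multiple z∈ in
      ≈-closed P (trans (sym z*1≈) (*-identityʳ _)) (*ₗ-closed P r x∈P)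
      where
      _∶_ : Carrier → Carrier → Ideal O
      x ∶ w = colon ⟨ x ⟩ w

      open All (On.wellFounded (x ∶_) (⊃-wellFounded em)) (c ⊔ ℓ) using (wfRec)

      Candidate : Carrier → Set (c ⊔ ℓ)
      Candidate w = x ∶ w ⊆ P → Escape P x

      ∶-⊆ : ∀ w u → x ∶ w ⊆ x ∶ (w * u)
      ∶-⊆ w u {z} zw∈ = ≈-closed ⟨ x ⟩ (*-assoc z w u) (*-closedʳ ⟨ x ⟩ zw∈ u)

      ∶-swap : ∀ {w u v} → v ∈ x ∶ (w * u) → v * u ∈ x ∶ w
      ∶-swap {w} {u} {v} = ≈-closed ⟨ x ⟩ (solve 3 (λ w u v → v :* (w :* u) := v :* u :* w) refl w u v)

      step : ∀ w → (∀ {w′} → x ∶ w′ ⊃ x ∶ w → Candidate w′) → Candidate w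
      step w rec w⊆P with em₀ {∃[ w′ ] x ∶ w′ ⊃ x ∶ w × x ∶ w′ ⊆ P}
      ... | yes (w′ , w′⊃w , w′⊆P) = rec w′⊃w w′⊆P
      ... | no ¬larger = record
        { y     = w
        ; y∉⟨x⟩ = λ w∈ → Q-proper λ z → *ₗ-closed ⟨ x ⟩ z w∈
        ; yP⊆xO = λ {p} p∈ → let r , pw≈rx = ∈⟨⟩⇒multiple (P⊆Q p∈) in
            r , trans (*-comm x r) (trans (sym pw≈rx) (*-comm p w))
        }
        where
        Q = x ∶ w

        Q-proper : Proper Q
        Q-proper all = P-proper λ z → w⊆P (all z)

        maximality : ∀ u → x ∶ (w * u) ⊆ P → x ∶ (w * u) ⊆ Q
        maximality u wu⊆P {z} z∈ = decidable-stable em₀ λ z∉ →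
          ¬larger (w * u , ((λ {v} → ∶-⊆ w u {v}) , λ ⊆Q → z∉ (⊆Q z∈)) , wu⊆P)

        -- If x ∶ (w u) lies in `P`, maximality puts it in `Q`, and it contains `v`. Otherwise
        -- choose `s` in it outside `P`. Any t in x ∶ (w s) has t s in `Q`, hence t in `P`; so
        -- maximality applies to x ∶ (w s), which contains `u`.
        Q-prime : ∀ u v → u * v ∈ Q → u ∈ Q ⊎ v ∈ Q
        Q-prime u v uv∈Q with em₀ {x ∶ (w * u) ⊆ P}
        ... | yes wu⊆P = inj₂ (maximality u wu⊆P (≈-closed ⟨ x ⟩
          (solve 3 (λ w u v → u :* v :* w := v :* (w :* u)) refl w u v) uv∈Q))
        ... | no wu⊈P with s , s∈ , s∉P ← ⊈⇒∃ (x ∶ (w * u)) P wu⊈P =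
          inj₁ (maximality s (λ t∈ → maximal⇒prime P P-max (w⊆P (∶-swap t∈)) s∉P)
            (≈-closed ⟨ x ⟩ (solve 3 (λ w u s → s :* (w :* u) := u :* (w :* s)) refl w u s) s∈))

        -- `Q` contains the nonzero `x`, so as a nonzero prime it is maximal, and it already lies in
        -- the proper ideal `P`.
        P⊆Q : P ⊆ Q
        P⊆Q = proj₂ (dimension≤1 Q (x , *-closedʳ ⟨ x ⟩ (a∈⟨a⟩ x) w , x≉0) (Q-proper , Q-prime))
          P P-proper w⊆P

    -- With y/x from `escape`, (y/x)P lies in O. If L were contained in LP, then (y/x)L would lie in
    -- L · (y/x)P and so in `L`, making `L` a nonzero ideal stable under y/x.
    ⊈-·-maximal : (L P : Ideal O) → Nonzero L → IsMaximal P → Nonzero P → ¬ (L ⊆ L ·ᴵ P)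
    ⊈-·-maximal L P L≠0 P-max (x , x∈P , x≉0) L⊆LP =
      y∉⟨x⟩ (stable⇒∈⟨⟩ x≉0 L (λ i∈ → ·-least L P xL/y scale (L⊆LP i∈)) L≠0)
      where
      open Escape (escape P P-max x≉0 x∈P)

      xL/y : Ideal O
      xL/y = record
        { member    = λ u → ∃[ i ] i ∈ L × x * i ≈ y * u
        ; ≈-closed  = λ u≈v (i , i∈ , eq) → i , i∈ , trans eq (*-congˡ u≈v)
        ; 0-closed  = 0# , 0-closed L , trans (zeroʳ x) (sym (zeroʳ y))
        ; +-closed  = λ {u} {v} (i , i∈ , eq) (j , j∈ , eq′) → i + j , +-closed L i∈ j∈ ,
            trans (distribˡ x i j) (trans (+-cong eq eq′) (sym (distribˡ y u v)))
        ; *ₗ-closed = λ s {u} (i , i∈ , eq) → s * i , *ₗ-closed L s i∈ , (begin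
            x * (s * i)  ≈⟨ solve 3 (λ x s i → x :* (s :* i) := s :* (x :* i)) refl x s i ⟩
            s * (x * i)  ≈⟨ *-congˡ eq ⟩
            s * (y * u)  ≈⟨ solve 3 (λ x s i → s :* (x :* i) := x :* (s :* i)) refl y s u ⟩
            y * (s * u)  ∎)
        }

      scale : ∀ {l p} → l ∈ L → p ∈ P → l * p ∈ xL/y
      scale {l} {p} l∈ p∈ = let p′ , xp′≈yp = yP⊆xO p∈ in l * p′ , *-closedʳ L l∈ p′ , (begin
        x * (l * p′)  ≈⟨ solve 3 (λ x s i → x :* (s :* i) := s :* (x :* i)) refl x l p′ ⟩
        l * (x * p′)  ≈⟨ *-congˡ xp′≈yp ⟩
        l * (y * p)   ≈⟨ solve 3 (λ x s i → s :* (x :* i) := x :* (s :* i)) refl y l p ⟩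
        y * (l * p)   ∎)

    -- Noetherian induction in place of Zorn's lemma: either some strictly larger proper ideal
    -- exists and the induction passes to it, or `I` itself is maximal.
    ∃-maximal : ∀ I → Proper I → Σ[ P ∈ Ideal O ] IsMaximal P × I ⊆ P
    ∃-maximal = wfRec (λ I → Proper I → Σ[ P ∈ Ideal O ] IsMaximal P × I ⊆ P) step
      where
      open All (⊃-wellFounded em) (lsuc (c ⊔ ℓ)) using (wfRec)

      step : ∀ I → (∀ {J} → J ⊃ I → Proper J → Σ[ P ∈ Ideal O ] IsMaximal P × J ⊆ P) →
             Proper I → Σ[ P ∈ Ideal O ] IsMaximal P × I ⊆ P
      step I rec I-proper with em {Σ[ J ∈ Ideal O ] Proper J × J ⊃ I}
      ... | yes (J , J-proper , J⊃I) = let P , P-max , J⊆P = rec {J} J⊃I J-proper in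
        P , P-max , λ x∈I → J⊆P (proj₁ J⊃I x∈I)
      ... | no ¬larger = I , (I-proper , λ J J-proper I⊆J {x} x∈J → decidable-stable em₀ λ x∉I →
        ¬larger (J , J-proper , I⊆J , λ J⊆I → x∉I (J⊆I x∈J))) , id

    -- Division by a maximal ideal.

    infixl 7 _÷_
    -- The ideal quotient (I : P), which stands in for the product of `I` with the inverse of `P`
    -- when I ⊆ P.
    _÷_ : Ideal O → Ideal O → Ideal O
    I ÷ P = record
      { member    = λ u → ∀ {p} → p ∈ P → u * p ∈ I
      ; ≈-closed  = λ u≈v u∈ p∈ → ≈-closed I (*-congʳ u≈v) (u∈ p∈)
      ; 0-closed  = λ _ → ≈-closed I (sym (zeroˡ _)) (0-closed I)
      ; +-closed  = λ u∈ v∈ p∈ → ≈-closed I (sym (distribʳ _ _ _)) (+-closed I (u∈ p∈) (v∈ p∈))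
      ; *ₗ-closed = λ s u∈ p∈ → ≈-closed I (sym (*-assoc s _ _)) (*ₗ-closed I s (u∈ p∈))
      }

    module _ (I P : Ideal O) (P-max : IsMaximal P) (I⊆P : I ⊆ P)
             {x : Carrier} (x∈I : x ∈ I) (x≉0 : ¬ (x ≈ 0#)) where

      open Escape (escape P P-max x≉0 (I⊆P x∈I))

      private
        P+[y/x]P : Ideal O
        P+[y/x]P = record
          { member    = λ u → ∃[ p ] ∃[ q ] p ∈ P × q ∈ P × x * u ≈ x * p + y * q
          ; ≈-closed  = λ u≈v (p , q , p∈ , q∈ , eq) → p , q , p∈ , q∈ , trans (*-congˡ (sym u≈v)) eq
          ; 0-closed  = 0# , 0# , 0-closed P , 0-closed P ,
              solve 2 (λ x y → x :* con 0 := x :* con 0 :+ y :* con 0) refl x y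
          ; +-closed  = λ {u} {v} (p , q , p∈ , q∈ , eq) (p′ , q′ , p′∈ , q′∈ , eq′) →
              p + p′ , q + q′ , +-closed P p∈ p′∈ , +-closed P q∈ q′∈ , (begin
                x * (u + v)                              ≈⟨ distribˡ x u v ⟩
                x * u + x * v                            ≈⟨ +-cong eq eq′ ⟩
                (x * p + y * q) + (x * p′ + y * q′)
                  ≈⟨ solve 6 (λ x y p q p′ q′ → (x :* p :+ y :* q) :+ (x :* p′ :+ y :* q′) :=
                       x :* (p :+ p′) :+ y :* (q :+ q′)) refl x y p q p′ q′ ⟩
                x * (p + p′) + y * (q + q′)              ∎)
          ; *ₗ-closed = λ s {u} (p , q , p∈ , q∈ , eq) →
              s * p , s * q , *ₗ-closed P s p∈ , *ₗ-closed P s q∈ , (begin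
                x * (s * u)                ≈⟨ solve 3 (λ x s u → x :* (s :* u) := s :* (x :* u)) refl x s u ⟩
                s * (x * u)                ≈⟨ *-congˡ eq ⟩
                s * (x * p + y * q)        ≈⟨ solve 5 (λ x y p q s → s :* (x :* p :+ y :* q) :=
                                                x :* (s :* p) :+ y :* (s :* q)) refl x y p q s ⟩
                x * (s * p) + y * (s * q)  ∎)
          }

        P⊆ : P ⊆ P+[y/x]P
        P⊆ {p} p∈ = p , 0# , p∈ , 0-closed P , solve 3 (λ x y p → x :* p := x :* p :+ y :* con 0) refl x y _

        -- Otherwise P + (y/x)P is a proper ideal containing `P`, hence contained in `P` by
        -- maximality, and y/x stabilises `P`, which contains the nonzero `x`.
        1∈P+[y/x]P : 1# ∈ P+[y/x]P
        1∈P+[y/x]P = decidable-stable em₀ λ 1∉ → y∉⟨x⟩ (stable⇒∈⟨⟩ x≉0 P (P-stable 1∉) (x , I⊆P x∈I , x≉0))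
          where
          P-stable : 1# ∉ P+[y/x]P → ∀ {p} → p ∈ P → ∃[ p′ ] p′ ∈ P × x * p′ ≈ y * p
          P-stable 1∉ {p} p∈ = let p′ , xp′≈yp = yP⊆xO p∈ in
            p′ ,
            proj₂ P-max P+[y/x]P (λ all → 1∉ (all 1#)) P⊆
              (0# , p , 0-closed P , p∈ ,
               trans xp′≈yp (solve 3 (λ x y p → y :* p := x :* con 0 :+ y :* p) refl x y p)) ,
            xp′≈yp

        -- The element (y/x)i lies in O because I ⊆ P. Multiplied by p in `P` it becomes i · (y/x)p,
        -- again in `I` because (y/x)p is in O.
        scale : ∀ {i} → i ∈ I → ∃[ i′ ] i′ ∈ I ÷ P × x * i′ ≈ y * i
        scale {i} i∈ with i′ , xi′≈yi ← yP⊆xO (I⊆P i∈) = i′ , i′∈ , xi′≈yi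
          where
          i′∈ : i′ ∈ I ÷ P
          i′∈ {p} p∈ with p′ , xp′≈yp ← yP⊆xO p∈ = ≈-closed I
            (*-cancelˡ x≉0 (begin
              x * (i * p′)  ≈⟨ solve 3 (λ x s i → x :* (s :* i) := s :* (x :* i)) refl x i p′ ⟩
              i * (x * p′)  ≈⟨ *-congˡ xp′≈yp ⟩
              i * (y * p)   ≈⟨ solve 3 (λ i y p → i :* (y :* p) := (y :* i) :* p) refl i y p ⟩
              y * i * p     ≈⟨ *-congʳ xi′≈yi ⟨
              x * i′ * p    ≈⟨ *-assoc x i′ p ⟩
              x * (i′ * p)  ∎))
            (*-closedʳ I i∈ p′)

      -- If I ÷ P were no larger than `I`, `scale` would make `I` stable under y/x.
      ÷-strict : I ÷ P ⊃ I
      ÷-strict = (λ i∈ _ → *-closedʳ I i∈ _) , λ ÷⊆I → y∉⟨x⟩ (stable⇒∈⟨⟩ x≉0 I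
        (λ i∈ → let i′ , i′∈ , eq = scale i∈ in i′ , ÷⊆I i′∈ , eq) (x , x∈I , x≉0))

      -- Multiply 1 = p + (y/x)q by `i`: both `i` and (y/x)i lie in `I ÷ P`, and `p`, `q` lie in
      -- `P`. Cancelling `x` removes the denominators.
      ·-÷ : I ≐ P ·ᴵ (I ÷ P)
      ·-÷ = ⊆ , ·-least P (I ÷ P) I λ p∈ u∈ → ≈-closed I (*-comm _ _) (u∈ p∈)
        where
        ⊆ : I ⊆ P ·ᴵ (I ÷ P)
        ⊆ {i} i∈ =
          let p , q , p∈ , q∈ , eq = 1∈P+[y/x]P
              i′ , i′∈ , eq′       = scale i∈
          in ≈-closed N
            (*-cancelˡ x≉0 (begin
              x * (p * i + q * i′)        ≈⟨ solve 5 (λ x p i q i′ → x :* (p :* i :+ q :* i′) :=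
                                               x :* p :* i :+ q :* (x :* i′)) refl x p i q i′ ⟩
              x * p * i + q * (x * i′)    ≈⟨ +-congˡ (*-congˡ eq′) ⟩
              x * p * i + q * (y * i)     ≈⟨ solve 5 (λ x p i q y → x :* p :* i :+ q :* (y :* i) :=
                                               (x :* p :+ y :* q) :* i) refl x p i q y ⟩
              (x * p + y * q) * i         ≈⟨ *-congʳ eq ⟨
              x * 1# * i                  ≈⟨ *-congʳ (*-identityʳ x) ⟩
              x * i                       ∎))
            (+-closed N (·-intro P (I ÷ P) p∈ (proj₁ ÷-strict i∈)) (·-intro P (I ÷ P) q∈ i′∈))
          where N = P ·ᴵ (I ÷ P)

    -- Factorisation into maximal ideals.

    data Factorisation (I : Ideal O) : Set (lsuc (c ⊔ ℓ)) where
      unit   : I ≐ ⟨ 1# ⟩ → Factorisation I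
      factor : ∀ P {J} → IsMaximal P → Nonzero P → I ≐ P ·ᴵ J → Factorisation J → Factorisation I

    -- Splitting off a maximal ideal above `I` leaves the strictly larger `I ÷ P`, so the process
    -- ends at the unit ideal.
    factorise : ∀ I → Nonzero I → Factorisation I
    factorise = wfRec (λ I → Nonzero I → Factorisation I) step
      where
      open All (⊃-wellFounded em) (lsuc (c ⊔ ℓ)) using (wfRec)

      step : ∀ I → (∀ {J} → J ⊃ I → Nonzero J → Factorisation J) → Nonzero I → Factorisation I
      step I rec (x , x∈I , x≉0) with em₀ {∀ x → x ∈ I}
      ... | yes all = unit ((λ {z} _ → multiple⇒∈⟨⟩ z (sym (*-identityʳ z))) , λ {z} _ → all z)
      ... | no I-proper with P , P-max , I⊆P ← ∃-maximal I I-proper =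
        factor P {I ÷ P} P-max (x , I⊆P x∈I , x≉0) (·-÷ I P P-max I⊆P x∈I x≉0)
          (rec ÷⊃I (x , proj₁ ÷⊃I x∈I , x≉0))
        where ÷⊃I = ÷-strict I P P-max I⊆P x∈I x≉0

    -- One list of maximal ideals serves both factorisations, so an exponent may vanish on one side.
    -- `occurs` excludes vanishing on both and later supplies `k≢0`.
    record JointFactorisation (A B : Ideal O) : Set (lsuc (c ⊔ ℓ)) where
      field
        r        : ℕ
        P        : Fin r → Ideal O
        α β      : Fin r → ℕ
        maximal  : ∀ i → IsMaximal (P i)
        nonzero  : ∀ i → Nonzero (P i)
        distinct : ∀ i j → i ≢ j → ¬ (P i ≐ P j)
        occurs   : ∀ i → α i ℕ.+ β i ≢ 0
        A≐       : A ≐ ∏ᴵ r (λ i → P i ^ᴵ α i)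
        B≐       : B ≐ ∏ᴵ r (λ i → P i ^ᴵ β i)

      pairwise : Pairwise r P
      pairwise i j i≢j = distinct-maximal⇒comaximal (P i) (P j) (maximal i) (maximal j) (distinct i j i≢j)

    flip-joint : ∀ {A B} → JointFactorisation A B → JointFactorisation B A
    flip-joint F = record
      { r = r ; P = P ; α = β ; β = α ; maximal = maximal ; nonzero = nonzero ; distinct = distinct
      ; occurs = λ i → occurs i ∘ ≡.trans (ℕ.+-comm (α i) (β i)) ; A≐ = B≐ ; B≐ = A≐ }
      where open JointFactorisation F

    insert : ∀ Q → IsMaximal Q → Nonzero Q → ∀ {A B C} → C ≐ Q ·ᴵ A →
             JointFactorisation A B → JointFactorisation C B
    insert Q Q-max Q≠0 {A} {B} {C} C≐QA F with em₀ {∃[ i ] JointFactorisation.P F i ≐ Q}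
    ... | yes (i , Pᵢ≐Q) = record
      { r = r ; P = P ; α = increment i α ; β = β
      ; maximal = maximal ; nonzero = nonzero ; distinct = distinct
      ; occurs = λ j → occurs j ∘ ℕ.n≤0⇒n≡0 ∘ ℕ.≤-trans (ℕ.+-monoˡ-≤ (β j) (≤-increment i α j)) ∘ ℕ.≤-reflexive
      ; A≐ = ≐R.begin
          C                                       ≐R.≈⟨ C≐QA ⟩
          Q ·ᴵ A                                  ≐R.≈⟨ ·-cong {Q} {P i} {A} {A′} (swap Pᵢ≐Q) A≐ ⟩
          P i ·ᴵ A′                               ≐R.≈⟨ ∏-increment r P α i ⟨
          ∏ᴵ r (λ j → P j ^ᴵ increment i α j)     ≐R.∎
      ; B≐ = B≐
      }
      where
      module ≐R = ≐-Reasoning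
      open JointFactorisation F
      A′ = ∏ᴵ r (λ j → P j ^ᴵ α j)
    ... | no Q∉P = record
      { r = suc r
      ; P = λ { zero → Q ; (suc i) → P i }
      -- The new ideal divides the first ideal once and enters the second with exponent 0, where it
      -- contributes only the factor `⟨ 1# ⟩`.
      ; α = λ { zero → 1 ; (suc i) → α i }
      ; β = λ { zero → 0 ; (suc i) → β i }
      ; maximal = λ { zero → Q-max ; (suc i) → maximal i }
      ; nonzero = λ { zero → Q≠0 ; (suc i) → nonzero i }
      ; distinct = λ
        { zero    zero    0≢0 → contradiction ≡.refl 0≢0
        ; zero    (suc j) _   → λ Q≐P → Q∉P (j , swap Q≐P)
        ; (suc i) zero    _   → λ P≐Q → Q∉P (i , P≐Q)
        ; (suc i) (suc j) i≢j → distinct i j (i≢j ∘ ≡.cong suc)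
        }
      ; occurs = λ { zero () ; (suc i) → occurs i }
      ; A≐ = ≐R.begin
          C                        ≐R.≈⟨ C≐QA ⟩
          Q ·ᴵ A                   ≐R.≈⟨ ·-cong {Q} {Q ·ᴵ ⟨ 1# ⟩} {A} {A′} (swap (·-identityʳ Q)) A≐ ⟩
          Q ·ᴵ ⟨ 1# ⟩ ·ᴵ A′        ≐R.∎
      ; B≐ = ≐R.begin
          B                        ≐R.≈⟨ B≐ ⟩
          B′                       ≐R.≈⟨ ·-identityˡ B′ ⟨
          ⟨ 1# ⟩ ·ᴵ B′             ≐R.∎
      }
      where
      module ≐R = ≐-Reasoning
      open JointFactorisation F
      A′ = ∏ᴵ r (λ j → P j ^ᴵ α j)
      B′ = ∏ᴵ r (λ j → P j ^ᴵ β j)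

    joint-factorise : ∀ {A B} → Factorisation A → Factorisation B → JointFactorisation A B
    joint-factorise (unit A≐1) (unit B≐1) = record
      { r = 0 ; P = λ () ; α = λ () ; β = λ () ; maximal = λ () ; nonzero = λ () ; distinct = λ ()
      ; occurs = λ () ; A≐ = A≐1 ; B≐ = B≐1 }
    joint-factorise A@(unit _) (factor P P-max P≠0 B≐ FB) =
      -- `insert` multiplies only the first ideal, so factors of the second are inserted with the
      -- two sides exchanged.
      flip-joint (insert P P-max P≠0 B≐ (flip-joint (joint-factorise A FB)))
    joint-factorise (factor P P-max P≠0 A≐ FA) FB = insert P P-max P≠0 A≐ (joint-factorise FA FB)

-- Maps into quotients and direct sums

module _ {r ℓr : Level} {R : CommutativeRing r ℓr} where

  IsHom : ∀ {m ℓm n ℓn} (M : Module R m ℓm) (N : Module R n ℓn) →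
          (Module.Carrierᴹ M → Module.Carrierᴹ N) → Set (r ⊔ m ⊔ ℓm ⊔ ℓn)
  IsHom M N = ModuleMorphisms.IsModuleHomomorphism (Module.rawModule M) (Module.rawModule N)

  -- `⨁` is an iterated pair; `tuple` and `component` translate between it and dependent families,
  -- which the Chinese remainder theorem uses.
  tuple : ∀ {n ℓn} k (N : Fin k → Module R n ℓn) → (∀ i → Module.Carrierᴹ (N i)) → Module.Carrierᴹ (⨁ k N)
  tuple zero    N x = _
  tuple (suc k) N x = x zero , tuple k (N ∘ suc) (x ∘ suc)

  component : ∀ {n ℓn} k (N : Fin k → Module R n ℓn) → Module.Carrierᴹ (⨁ k N) → ∀ i → Module.Carrierᴹ (N i)
  component (suc k) N (x , _)  zero    = x
  component (suc k) N (_ , xs) (suc i) = component k (N ∘ suc) xs i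

  module _ {m ℓm} {M : Module R m ℓm} where

    open ModuleMorphisms.IsModuleHomomorphism

    ⟨,⟩-isHom : ∀ {n ℓn n′ ℓn′} {N : Module R n ℓn} {N′ : Module R n′ ℓn′} {f g} →
                IsHom M N f → IsHom M N′ g → IsHom M (N ⊕ N′) (λ x → f x , g x)
    ⟨,⟩-isHom F G = record
      { isBimoduleHomomorphism = record
        { +ᴹ-isGroupHomomorphism = record
          { isMonoidHomomorphism = record
            { isMagmaHomomorphism = record
              { isRelHomomorphism = record { cong = λ x≈y → ⟦⟧-cong F x≈y , ⟦⟧-cong G x≈y }
              ; homo = λ x y → +ᴹ-homo F x y , +ᴹ-homo G x y
              }
            ; ε-homo = 0ᴹ-homo F , 0ᴹ-homo G
            }
          ; ⁻¹-homo = λ x → -ᴹ-homo F x , -ᴹ-homo G x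
          }
        ; *ₗ-homo = λ s x → *ₗ-homo F s x , *ₗ-homo G s x
        ; *ᵣ-homo = λ s x → *ᵣ-homo F s x , *ᵣ-homo G s x
        }
      }

    tuple-isHom : ∀ {n ℓn} k (N : Fin k → Module R n ℓn) {f : Module.Carrierᴹ M → ∀ i → Module.Carrierᴹ (N i)} →
                  (∀ i → IsHom M (N i) (λ x → f x i)) → IsHom M (⨁ k N) (λ x → tuple k N (f x))
    tuple-isHom zero    N F = _
    tuple-isHom (suc k) N F =
      ⟨,⟩-isHom {N = N zero} {N′ = ⨁ k (N ∘ suc)} (F zero) (tuple-isHom k (N ∘ suc) (F ∘ suc))

  tuple-injective : ∀ {n ℓn} k (N : Fin k → Module R n ℓn) {x y} →
                    Module._≈ᴹ_ (⨁ k N) (tuple k N x) (tuple k N y) → ∀ i → Module._≈ᴹ_ (N i) (x i) (y i)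
  tuple-injective (suc k) N (x≈y , _)   zero    = x≈y
  tuple-injective (suc k) N (_ , xs≈ys) (suc i) = tuple-injective k (N ∘ suc) xs≈ys i

  tuple-component : ∀ {n ℓn} k (N : Fin k → Module R n ℓn) {x} y →
                    (∀ i → Module._≈ᴹ_ (N i) (x i) (component k N y i)) → Module._≈ᴹ_ (⨁ k N) (tuple k N x) y
  tuple-component zero    N y        x≈y = _
  tuple-component (suc k) N (y , ys) x≈y = x≈y zero , tuple-component k (N ∘ suc) ys (x≈y ∘ suc)

  quotient-isHom : ∀ {m ℓm n ℓn p q} {M : Module R m ℓm} {N : Module R n ℓn}
                   (S : Submodule M p) (T : Submodule N q) {f} →
                   IsHom M N f → (∀ {x} → x ∈ S → f x ∈ T) → IsHom (M / S) (N / T) f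
  quotient-isHom {M = M} {N = N} S T {f} F S⇒T = record
    { isBimoduleHomomorphism = record
      { +ᴹ-isGroupHomomorphism = record
        { isMonoidHomomorphism = record
          { isMagmaHomomorphism = record
            { isRelHomomorphism = record
              { cong = λ {x} {y} x-y∈S → ≈-closed T
                  (N.≈ᴹ-trans (F.+ᴹ-homo x (M.-ᴹ y)) (N.+ᴹ-congˡ (F.-ᴹ-homo y))) (S⇒T x-y∈S) }
            ; homo = λ x y → difference (F.+ᴹ-homo x y)
            }
          ; ε-homo = difference F.0ᴹ-homo
          }
        ; ⁻¹-homo = λ x → difference (F.-ᴹ-homo x)
        }
      ; *ₗ-homo = λ s x → difference (F.*ₗ-homo s x)
      ; *ᵣ-homo = λ s x → difference (F.*ₗ-homo s x)
      }
    }
    where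
    module M = Module M
    module N = Module N
    module F = ModuleMorphisms.IsModuleHomomorphism F
    open Submodule
    difference : ∀ {x y} → x N.≈ᴹ y → x N.+ᴹ N.-ᴹ y ∈ T
    difference {x} {y} x≈y = ≈-closed T (N.≈ᴹ-sym (N.≈ᴹ-trans (N.+ᴹ-congʳ x≈y) (N.-ᴹ‿inverseʳ y))) (0-closed T)

-- Linear forms on the free module of rank two.

module _ {c ℓ : Level} (O : CommutativeRing c ℓ) where
  open CommutativeRing O hiding (zero)
  open SetoidReasoning setoid
  open SemiringSolver commutativeSemiring using (solve; con; _:=_; _:+_; _:*_)

  linearForm : Carrier → Carrier → Carrier × Carrier → Carrier
  linearForm a b (u , v) = a * u + b * v

  linearForm-isHom : ∀ a b → IsHom (O² O) (O¹ O) (linearForm a b)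
  linearForm-isHom a b = record
    { isBimoduleHomomorphism = record
      { +ᴹ-isGroupHomomorphism = record
        { isMonoidHomomorphism = record
          { isMagmaHomomorphism = record
            { isRelHomomorphism = record { cong = λ (u≈ , v≈) → +-cong (*-congˡ u≈) (*-congˡ v≈) }
            ; homo = λ (u , v) (u′ , v′) → solve 6 (λ a b u v u′ v′ → a :* (u :+ u′) :+ b :* (v :+ v′) :=
                (a :* u :+ b :* v) :+ (a :* u′ :+ b :* v′)) refl a b u v u′ v′
            }
          ; ε-homo = solve 2 (λ a b → a :* con 0 :+ b :* con 0 := con 0) refl a b
          }
        ; ⁻¹-homo = λ (u , v) → begin
            a * - u + b * - v      ≈⟨ +-cong (-‿distribʳ-* a u) (-‿distribʳ-* b v) ⟨
            - (a * u) + - (b * v)  ≈⟨ AbelianGroupProperties.⁻¹-∙-comm +-abelianGroup (a * u) (b * v) ⟩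
            - (a * u + b * v)      ∎
        }
      ; *ₗ-homo = λ s (u , v) → solve 5 (λ a b s u v → a :* (s :* u) :+ b :* (s :* v) :=
          s :* (a :* u :+ b :* v)) refl a b s u v
      ; *ᵣ-homo = λ s (u , v) → solve 5 (λ a b s u v → a :* (u :* s) :+ b :* (v :* s) :=
          (a :* u :+ b :* v) :* s) refl a b s u v
      }
    }
    where open RingProperties ring using (-‿distribʳ-*)

  bezout : (p : UnimodularPair O) → let open UnimodularPair p in ∃[ r ] ∃[ s ] 1# ≈ r * a + s * b
  bezout record { a = a ; b = b ; unimodular = unimodular } =
    let _ , _ , x∈ , y∈ , 1≈ = +ᴵ⊆sum ⟨ a ⟩ ⟨ b ⟩ (unimodular 1#)
        r , x≈ = ∈⟨⟩⇒multiple x∈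
        s , y≈ = ∈⟨⟩⇒multiple y∈
    in r , s , trans 1≈ (+-cong x≈ y≈)

-- The submodule with prescribed invariants.

module _ {c ℓ : Level} {O : CommutativeRing c ℓ} where
  open CommutativeRing O hiding (zero)
  open SetoidReasoning setoid
  open SemiringSolver commutativeSemiring using (solve; con; _:=_; _:+_; _:*_)
  open RingProperties ring using (-0#≈0#; -‿distribˡ-*; -‿distribʳ-*; -‿involutive)
  open Submodule

  module Construction (a b r s : Carrier) (1≈ra+sb : 1# ≈ r * a + s * b) (L K : Ideal O) where

    -- The coordinates with respect to the basis (a , b) , (- s , r) of O².
    α β : Carrier × Carrier → Carrier
    α = linearForm O r s
    β = linearForm O (- b) a

    fromCoordinates : Carrier → Carrier → Carrier × Carrier
    fromCoordinates x y = a * x + - s * y , b * x + r * y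

    private
      module α = ModuleMorphisms.IsModuleHomomorphism (linearForm-isHom O r s)
      module β = ModuleMorphisms.IsModuleHomomorphism (linearForm-isHom O (- b) a)

    α-from : ∀ x y → α (fromCoordinates x y) ≈ x
    α-from x y = begin
      r * (a * x + - s * y) + s * (b * x + r * y)
        -- The solver works over semirings, so `- s` enters as the opaque variable `o`; the leftover
        -- o + s is cancelled afterwards.
        ≈⟨ solve 7 (λ r s a b o x y → r :* (a :* x :+ o :* y) :+ s :* (b :* x :+ r :* y) :=
             (r :* a :+ s :* b) :* x :+ r :* y :* (o :+ s)) refl r s a b (- s) x y ⟩
      (r * a + s * b) * x + r * y * (- s + s)
        ≈⟨ +-cong (*-congʳ (sym 1≈ra+sb)) (*-congˡ (-‿inverseˡ s)) ⟩
      1# * x + r * y * 0#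
        ≈⟨ solve 2 (λ x z → con 1 :* x :+ z :* con 0 := x) refl x (r * y) ⟩
      x ∎

    β-from : ∀ x y → β (fromCoordinates x y) ≈ y
    β-from x y = begin
      - b * (a * x + - s * y) + a * (b * x + r * y)
        ≈⟨ solve 7 (λ r n a b o x y → n :* (a :* x :+ o :* y) :+ a :* (b :* x :+ r :* y) :=
             (r :* a :+ n :* o) :* y :+ a :* x :* (n :+ b)) refl r (- b) a b (- s) x y ⟩
      (r * a + - b * - s) * y + a * x * (- b + b)
        ≈⟨ +-cong (*-congʳ (+-congˡ -b*-s≈sb)) (*-congˡ (-‿inverseˡ b)) ⟩
      (r * a + s * b) * y + a * x * 0#
        ≈⟨ +-congʳ (*-congʳ (sym 1≈ra+sb)) ⟩
      1# * y + a * x * 0#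
        ≈⟨ solve 2 (λ x z → con 1 :* x :+ z :* con 0 := x) refl y (a * x) ⟩
      y ∎
      where
      -b*-s≈sb : - b * - s ≈ s * b
      -b*-s≈sb = begin
        - b * - s      ≈⟨ -‿distribˡ-* b (- s) ⟨
        - (b * - s)    ≈⟨ -‿cong (-‿distribʳ-* b s) ⟨
        - - (b * s)    ≈⟨ -‿involutive (b * s) ⟩
        b * s          ≈⟨ *-comm b s ⟩
        s * b          ∎

    M : Submodule (O² O) (c ⊔ ℓ)
    M = record
      { member    = λ x → α x ∈ L × β x ∈ K
      ; ≈-closed  = λ x≈y (αx∈ , βx∈) → ≈-closed L (α.⟦⟧-cong x≈y) αx∈ , ≈-closed K (β.⟦⟧-cong x≈y) βx∈
      ; 0-closed  = ≈-closed L (sym α.0ᴹ-homo) (0-closed L) , ≈-closed K (sym β.0ᴹ-homo) (0-closed K)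
      ; +-closed  = λ {x} {y} (αx∈ , βx∈) (αy∈ , βy∈) →
          ≈-closed L (sym (α.+ᴹ-homo x y)) (+-closed L αx∈ αy∈) ,
          ≈-closed K (sym (β.+ᴹ-homo x y)) (+-closed K βx∈ βy∈)
      ; *ₗ-closed = λ z {x} (αx∈ , βx∈) →
          ≈-closed L (sym (α.*ₗ-homo z x)) (*ₗ-closed L z αx∈) ,
          ≈-closed K (sym (β.*ₗ-homo z x)) (*ₗ-closed K z βx∈)
      }

    M-proper : Proper K → Proper M
    M-proper K-proper all = K-proper λ y → ≈-closed K (β-from 0# y) (proj₂ (all (fromCoordinates 0# y)))

    -- One nonzero `z` in `K` annihilates the whole quotient, because it also lies in `L`. Vanishing
    -- in the quotient unfolds to a difference with zero, whence `x≈x-0`.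
    M-cotorsion : Nonzero K → K ⊆ L → IsCotorsion M
    M-cotorsion (z , z∈K , z≉0) K⊆L x@(u , v) = z , z≉0 , ≈-closed M (x≈x-0 (z * u) , x≈x-0 (z * v))
      ( ≈-closed L (sym (α.*ₗ-homo z x)) (*-closedʳ L (K⊆L z∈K) (α x))
      , ≈-closed K (sym (β.*ₗ-homo z x)) (*-closedʳ K z∈K (β x)))
      where
      x≈x-0 : ∀ w → w ≈ w - 0#
      x≈x-0 w = sym (trans (+-congˡ -0#≈0#) (+-identityʳ w))

    -- The coordinates of t(a , b) are `t` and 0.
    ∈M : ∀ {t} → t ∈ L → (t * a , t * b) ∈ M
    ∈M {t} t∈ = ≈-closed L (sym αt≈t) t∈ , ≈-closed K (sym βt≈0) (0-closed K)
      where
      αt≈t : α (t * a , t * b) ≈ t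
      αt≈t = begin
        r * (t * a) + s * (t * b)  ≈⟨ solve 5 (λ r s a b t → r :* (t :* a) :+ s :* (t :* b) := (r :* a :+ s :* b) :* t) refl r s a b t ⟩
        (r * a + s * b) * t        ≈⟨ *-congʳ 1≈ra+sb ⟨
        1# * t                     ≈⟨ *-identityˡ t ⟩
        t                          ∎
      βt≈0 : β (t * a , t * b) ≈ 0#
      βt≈0 = begin
        - b * (t * a) + a * (t * b)  ≈⟨ solve 4 (λ n a b t → n :* (t :* a) :+ a :* (t :* b) := a :* t :* (n :+ b)) refl (- b) a b t ⟩
        a * t * (- b + b)            ≈⟨ *-congˡ (-‿inverseˡ b) ⟩
        a * t * 0#                   ≈⟨ zeroʳ (a * t) ⟩
        0#                           ∎

    module _ n (A B : Fin n → Ideal O) (A⊥ : Pairwise n A) (B⊥ : Pairwise n B)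
             (L≐ : L ≐ ∏ᴵ n A) (K≐ : K ≐ ∏ᴵ n B) where

      private
        Q : Fin n → Module O c (c ⊔ ℓ)
        Q i = (O¹ O / A i) ⊕ (O¹ O / B i)

        f : Carrier × Carrier → Module.Carrierᴹ (⨁ n Q)
        f x = tuple n Q (λ i → α x , β x)

        f-isHom : IsHom (O² O / M) (⨁ n Q) f
        f-isHom = tuple-isHom {M = O² O / M} n Q λ i → ⟨,⟩-isHom {M = O² O / M} {N = O¹ O / A i} {N′ = O¹ O / B i}
          (quotient-isHom M (A i) (linearForm-isHom O r s) (∏⊆ n A i ∘ proj₁ L≐ ∘ proj₁))
          (quotient-isHom M (B i) (linearForm-isHom O (- b) a) (∏⊆ n B i ∘ proj₁ K≐ ∘ proj₂))

        f-injective : ∀ {x y} → Module._≈ᴹ_ (⨁ n Q) (f x) (f y) → Module._≈ᴹ_ (O² O / M) x y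
        f-injective {x} {y} fx≈fy =
          ≈-closed L (sym (trans (α.+ᴹ-homo x _) (+-congˡ (α.-ᴹ-homo y))))
            (proj₂ L≐ (∩⊆∏ n A A⊥ (proj₁ ∘ components))) ,
          ≈-closed K (sym (trans (β.+ᴹ-homo x _) (+-congˡ (β.-ᴹ-homo y))))
            (proj₂ K≐ (∩⊆∏ n B B⊥ (proj₂ ∘ components)))
          where components = tuple-injective n Q fx≈fy

        f-surjective : ∀ q → ∃[ x ] ∀ {z} → Module._≈ᴹ_ (O² O / M) z x → Module._≈ᴹ_ (⨁ n Q) (f z) q
        f-surjective q =
          let x , x≡ = chineseRemainder n A A⊥ (proj₁ ∘ component n Q q)
              y , y≡ = chineseRemainder n B B⊥ (proj₂ ∘ component n Q q)
          in fromCoordinates x y , λ z≈ → Module.≈ᴹ-trans (⨁ n Q)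
               (ModuleMorphisms.IsModuleHomomorphism.⟦⟧-cong f-isHom z≈)
               (tuple-component n Q q λ i →
                 ≈-closed (A i) (+-congʳ (sym (α-from x y))) (x≡ i) ,
                 ≈-closed (B i) (+-congʳ (sym (β-from x y))) (y≡ i))

      -- The Chinese remainder theorem is applied to each coordinate separately: `∩⊆∏` gives
      -- injectivity, and simultaneous congruences for `α` and `β` give surjectivity.
      quotient≅⨁ : O² O / M ≅ ⨁ n Q
      quotient≅⨁ = f , record
        { isModuleMonomorphism = record
          { isModuleHomomorphism = f-isHom
          ; injective = f-injective
          }
        ; surjective = f-surjective
        }

-- Realisation of the given invariants.

mainTheorem2 : ∀ {c ℓ : Level} → ExcludedMiddle (lsuc (c ⊔ ℓ)) →
    (O : CommutativeRing c ℓ) → IsDedekindDomain O →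
    (L K I : Ideal O) → Nonzero L → Nonzero K → K ⊆ L → Proper K →
    K ≐ L ·ᴵ I →
    (p : Setoid.Carrier (PF¹ I)) →
    Σ[ M ∈ Submodule (O² O) (c ⊔ ℓ) ]
    Proper M × IsCotorsion M ×
    Σ[ E ∈ ElementaryDivisors M ]
    (ElementaryDivisors.𝓛 E ≐ L) ×
    (ElementaryDivisors.𝓚 E ≐ K) ×
    (ElementaryDivisors.𝓘 E ≐ I) ×
    ElementaryDivisors.IsProjectiveInvariant E p
mainTheorem2 em O dedekind L K I L≠0@(z , z∈L , z≉0) K≠0@(x , x∈K , x≉0) K⊆L K-proper K≐LI p =
  M , M-proper K-proper , M-cotorsion K≠0 K⊆L , E , swap L≐ , swap K≐ , swap I≐ ,
  p , Setoid.refl (PF¹ 𝓘) {p} , t , t∈𝓛 , t∉ , ∈M (proj₂ L≐ t∈𝓛)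
  where
  open Classical em
  open Dedekind em dedekind
  open UnimodularPair p

  rs = bezout O p

  open Construction a b (proj₁ rs) (proj₁ (proj₂ rs)) (proj₂ (proj₂ rs)) L K

  joint : JointFactorisation L I
  -- `I` is nonzero because K = LI lies in it and contains the nonzero `x`.
  joint = joint-factorise (factorise L L≠0) (factorise I (x , ·⊆ʳ L I (proj₁ K≐LI x∈K) , x≉0))

  open JointFactorisation joint renaming (α to l; β to e; A≐ to L≐; B≐ to I≐∏)

  k : Fin r → ℕ
  k i = l i ℕ.+ e i

  K≐ : K ≐ ∏ᴵ r (λ i → P i ^ᴵ k i)
  K≐ = ≐R.begin
    K                                        ≐R.≈⟨ K≐LI ⟩
    L ·ᴵ I                                   ≐R.≈⟨ ·-cong {I = L} {∏ᴵ r Pˡ} {I} {∏ᴵ r Pᵉ} L≐ I≐∏ ⟩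
    ∏ᴵ r Pˡ ·ᴵ ∏ᴵ r Pᵉ                       ≐R.≈⟨ ∏-· r Pˡ Pᵉ ⟨
    ∏ᴵ r (λ i → Pˡ i ·ᴵ Pᵉ i)                ≐R.≈⟨ ∏-cong r (λ i → ^-+ (P i) (l i) (e i)) ⟨
    ∏ᴵ r (λ i → P i ^ᴵ k i)                  ≐R.∎
    where
    module ≐R = ≐-Reasoning
    Pˡ Pᵉ : Fin r → Ideal O
    Pˡ i = P i ^ᴵ l i
    Pᵉ i = P i ^ᴵ e i

  powers-pairwise : ∀ m → Pairwise r (λ i → P i ^ᴵ m i)
  powers-pairwise m i j i≢j = comaximal-^^ (P i) (P j) (pairwise i j i≢j) (m i) (m j)

  E : ElementaryDivisors M
  E = record
    { r = r ; 𝓜 = P ; l = l ; k = k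
    ; 𝓜-maximal  = maximal
    ; 𝓜-distinct = distinct
    ; l≤k        = λ i → ℕ.m≤m+n (l i) (e i)
    ; k≢0        = occurs
    ; quotient≅  = quotient≅⨁ r (λ i → P i ^ᴵ l i) (λ i → P i ^ᴵ k i) (powers-pairwise l) (powers-pairwise k) L≐ K≐
    }

  open ElementaryDivisors E using (𝓛; 𝓘)

  I≐ : I ≐ 𝓘
  -- The exponents of `𝓘` are (l + e) ∸ l, which equal `e` only propositionally.
  I≐ = ≐-trans {I = I} {J = ∏ᴵ r (λ i → P i ^ᴵ e i)} {K = 𝓘} I≐∏ (∏-cong r λ i →
    ≡.subst (λ m → P i ^ᴵ e i ≐ P i ^ᴵ m) (≡.sym (ℕ.m+n∸m≡n (l i) (e i))) (≐-refl {I = P i ^ᴵ e i}))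

  t-exists : ∃[ t ] t ∈ 𝓛 × (∀ i → t ∉ 𝓛 ·ᴵ P i)
  -- For each single i a witness exists because 𝓛 is not contained in 𝓛 Pᵢ; `avoidance` merges them
  -- into one `t`.
  t-exists = avoidance 𝓛 r P pairwise λ i →
    ⊈⇒∃ 𝓛 (𝓛 ·ᴵ P i) (⊈-·-maximal 𝓛 (P i) (z , proj₁ L≐ z∈L , z≉0) (maximal i) (nonzero i))

  t   = proj₁ t-exists
  t∈𝓛 = proj₁ (proj₂ t-exists)
  t∉  = proj₂ (proj₂ t-exists)
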